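{- Let $\alpha_1,\alpha_2,\lambda_1,\lambda_2$ be nonzero algebraic numbers, let $K=\mathbb{Q}(\lambda_1,\lambda_2,\alpha_1,\alpha_2)$, and for $i\ge0$ put $m_i=\lambda_1\alpha_1^i+\lambda_2\alpha_2^i$. Then there exists a constant $C$ depending only on $m_0,m_1,m_2,m_3,\lambda_1,\lambda_2$ such that if $m_i\in\mathcal{O}_K$ for all $1\le i\le C$, then $\alpha_1,\alpha_2\in\mathcal{O}_K$.
   Context: $\mathcal{O}_K$ denotes the ring of integers of the number field $K$.
   Formalization: The case α₁ = α₂ with λ₁ + λ₂ = 0 is excluded: there all m_i vanish while α₁ = α₂ is arbitrary (e.g. λ₁ = 1, λ₂ = −1, α₁ = α₂ = 1/2), so the statement is false without this exclusion. -}

module Defs where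

open import Algebra.Apartness.Bundles using (HeytingField; HeytingCommutativeRing)
open import Algebra.Bundles using (CommutativeRing)
open import Data.Integer.Base using (ℤ; +_; -[1+_]; 0ℤ; 1ℤ)
open import Data.List.Base using (List; []; _∷_; _++_; [_]; foldr; map)
open import Data.List.Relation.Unary.Any using (Any)
open import Data.Nat.Base using (ℕ; suc)
open import Data.Product.Base using (∃-syntax; _×_)
open import Level using (Level; _⊔_) renaming (suc to lsuc)
open import Relation.Binary.Definitions using (Decidable)
open import Relation.Binary.PropositionalEquality.Core using (_≢_)
open import Relation.Nullary.Negation.Core using (¬_)
open import Relation.Unary using (Pred)
import Algebra.Properties.Semiring.Exp as Exp
import Algebra.Properties.Semiring.Mult as Mult

module FieldNotions {c ℓ₁ ℓ₂ : Level} (F : HeytingField c ℓ₁ ℓ₂) where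

  open HeytingField F
  open CommutativeRing (HeytingCommutativeRing.commutativeRing heytingCommutativeRing)
    using (semiring)
  open Exp semiring using (_^_) public
  open Mult semiring using () renaming (_×_ to _·_)

  fromℤ : ℤ → Carrier
  fromℤ (+ n)    = n · 1#
  fromℤ -[1+ n ] = - (suc n · 1#)

  -- A polynomial is its list of coefficients, constant term first, so that
  -- p ++ [ 1 ] is the monic polynomial of degree length p with lower
  -- coefficients p.  Trailing zeros are allowed.
  eval : List Carrier → Carrier → Carrier
  eval p x = foldr (λ a r → a + x * r) 0# p

  evalℤ : List ℤ → Carrier → Carrier
  evalℤ p = eval (map fromℤ p)

  CharacteristicZero : Set ℓ₁
  CharacteristicZero = ∀ n → ¬ (suc n · 1# ≈ 0#)

  AlgebraicOverℚ : Pred Carrier ℓ₁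
  AlgebraicOverℚ x = ∃[ p ] (Any (_≢ 0ℤ) p × evalℤ p x ≈ 0#)

  IntegralOverℤ : Pred Carrier ℓ₁
  IntegralOverℤ x = ∃[ p ] (evalℤ (p ++ [ 1ℤ ]) x ≈ 0#)

  AlgebraicallyClosed : Set (c ⊔ ℓ₁)
  AlgebraicallyClosed = ∀ a p → ∃[ x ] (eval ((a ∷ p) ++ [ 1# ]) x ≈ 0#)

  -- ℚ⟨ xs ⟩ is the smallest subfield containing the members of xs.
  data ℚ⟨_⟩ (xs : List Carrier) : Pred Carrier (c ⊔ ℓ₁) where
    gen  : ∀ {x} → Any (x ≈_) xs → ℚ⟨ xs ⟩ x
    one  : ℚ⟨ xs ⟩ 1#
    add  : ∀ {x y} → ℚ⟨ xs ⟩ x → ℚ⟨ xs ⟩ y → ℚ⟨ xs ⟩ (x + y)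
    neg  : ∀ {x} → ℚ⟨ xs ⟩ x → ℚ⟨ xs ⟩ (- x)
    mul  : ∀ {x y} → ℚ⟨ xs ⟩ x → ℚ⟨ xs ⟩ y → ℚ⟨ xs ⟩ (x * y)
    inv  : ∀ {x y} → ℚ⟨ xs ⟩ x → x * y ≈ 1# → ℚ⟨ xs ⟩ y
    resp : ∀ {x y} → x ≈ y → ℚ⟨ xs ⟩ x → ℚ⟨ xs ⟩ y

  𝒪 : ∀ {k} → Pred Carrier k → Pred Carrier (k ⊔ ℓ₁)
  𝒪 K x = K x × IntegralOverℤ x

-- The field of algebraic numbers, characterised (up to isomorphism) as an
-- algebraic closure of ℚ.  Decidability of the apartness makes it a discrete
-- field: x # y is then equivalent to ¬ (x ≈ y), and _≈_ is decidable.
record AlgebraicNumbers (c ℓ₁ ℓ₂ : Level) : Set (lsuc (c ⊔ ℓ₁ ⊔ ℓ₂)) where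
  field
    heytingField : HeytingField c ℓ₁ ℓ₂

  open HeytingField heytingField public
  open FieldNotions heytingField public

  field
    _#?_                : Decidable _#_
    characteristicZero  : CharacteristicZero
    algebraic           : ∀ x → AlgebraicOverℚ x
    algebraicallyClosed : AlgebraicallyClosed

{-# OPTIONS --safe #-}
-- Write D = m₀ m₂ − m₁².  The Hankel identity
--   m_i m_{i+2} − m_{i+1}² = D (α₁ α₂)^i
-- makes D (α₁ α₂)^i integral for many i, which forces α₁ α₂ to be integral.  Then,
-- for an integer d with d λ₁ λ₂ integral, d λ₁ α₁^i and d λ₂ α₂^i have integral sum
-- and product, so they are integral and α₁, α₂ are forced to be integral as well.
-- If D = 0 then α₁ = α₂ and m_i = (λ₁ + λ₂) α₁^i.  The bound C is uniform because
-- m₀, …, m₃ determine α₁ + α₂ and α₁ α₂ (resp. α₁ = α₂) beforehand.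
--
-- The forcing step: let e ≠ 0 and e x^N be integral, N large.  If the monic equation
-- of e x^N holds at all roots of a degree n integer annihilator of x, then e y^N is
-- integral for each root y, and a coefficient q of the annihilator made monic,
-- being multilinear in the roots, has e^n q^N integral, hence in ℤ; as 2^N > |e|^n,
-- q ∈ ℤ.  Otherwise reduction modulo the annihilator gives one of smaller degree,
-- so that no minimal polynomial is needed.
module Submission where

open import Defs
open import Algebra.Apartness.Bundles using (HeytingCommutativeRing)
open import Algebra.Bundles using (CommutativeRing)
import Algebra.Properties.CommutativeSemiring.Exp as Exp
import Algebra.Properties.Ring as RingProperties
import Algebra.Properties.Semiring.Mult as Mult
import Algebra.Properties.Semiring.Mult.TCOptimised as Mult′
import Algebra.Solver.Ring as RingSolver
open import Algebra.Solver.Ring.AlmostCommutativeRing using (fromCommutativeRing; _-Raw-AlmostCommutative⟶_)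
open import Data.Empty using (⊥-elim)
open import Data.Integer.Base as ℤ using (ℤ; +_; -[1+_]; 0ℤ; 1ℤ)
import Data.Integer.Divisibility.Signed as ℤ∣
import Data.Integer.Properties as ℤ
open import Data.List.Base using (List; []; _∷_; [_]; _++_; map; length; cartesianProductWith; applyUpTo)
import Data.List.Membership.Setoid as Membership
import Data.List.Membership.Setoid.Properties as ∈
import Data.List.Properties as List
open import Data.List.Relation.Unary.All as All using (All; []; _∷_)
import Data.List.Relation.Unary.All.Properties as All
open import Data.List.Relation.Unary.Any using (here; there)
open import Data.Maybe.Base using (Maybe; just; nothing)
open import Data.Nat.Base as ℕ using (ℕ; zero; suc; _≤_; _<_; z≤n; s≤s)
open import Data.Nat.Coprimality as Coprimality using (Coprime)
open import Data.Nat.Divisibility using (_∣_; divides; ∣-refl; ∣-trans; ∣1⇒≡1; ∣⇒≤; *-cancelʳ-∣; *-monoˡ-∣)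
open import Data.Nat.GCD using (gcd; gcd[m,n]∣m; gcd[m,n]∣n; gcd-greatest; gcd[m,n]≡0⇒m≡0)
open import Data.Nat.Induction using (<-wellFounded)
import Data.Nat.Properties as ℕ
open import Data.Product.Base using (∃-syntax; _×_; _,_; proj₁; proj₂)
open import Data.Sum.Base using (_⊎_; inj₁; inj₂)
open import Data.Vec.Base as Vec using (Vec; []; _∷_)
import Data.Vec.Properties as Vec
open import Induction.WellFounded using (Acc; acc)
open import Level using (Level; _⊔_)
open import Relation.Binary.PropositionalEquality as ≡ using (_≡_; _≢_)
open import Relation.Nullary.Decidable.Core using (yes; no)
open import Relation.Nullary.Negation.Core using (¬_)
open import Relation.Unary using (Pred)

-- Integers inside the field, and a ring solver with integer coefficients.

module FieldProperties {c ℓ₁ ℓ₂} (Q̄ : AlgebraicNumbers c ℓ₁ ℓ₂) where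

  open AlgebraicNumbers Q̄ public hiding (zero; _^_)
  open CommutativeRing (HeytingCommutativeRing.commutativeRing heytingCommutativeRing) public
    using (semiring; commutativeSemiring; ring)
  open Exp commutativeSemiring public
  open RingProperties ring public
  open Mult semiring public using (×1-homo-*) renaming (_×_ to _·_; ×-homo-+ to ·-homo-+)
  open import Relation.Binary.Reasoning.Setoid setoid public

  fromℤ-neg : ∀ a → fromℤ (ℤ.- a) ≈ - fromℤ a
  fromℤ-neg (+ zero)  = sym -0#≈0#
  fromℤ-neg (+ suc n) = refl
  fromℤ-neg -[1+ n ]  = sym (-‿involutive _)

  private
    [x+y]-[x+z]≈y-z : ∀ x y z → (x + y) - (x + z) ≈ y - z
    [x+y]-[x+z]≈y-z x y z = begin
      (x + y) - (x + z)       ≈⟨ +-congˡ (-‿+-comm x z) ⟨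
      (x + y) + (- x + - z)   ≈⟨ +-assoc _ _ _ ⟨
      x + y + - x + - z       ≈⟨ +-congʳ (xyx⁻¹≈y x y) ⟩
      y - z                   ∎

  -- Sums of mixed sign compute to `⊖`, so this settles two of the four cases of `fromℤ-+`.
  fromℤ-⊖ : ∀ m n → fromℤ (m ℤ.⊖ n) ≈ m · 1# - n · 1#
  fromℤ-⊖ m       zero    = begin
    fromℤ (m ℤ.⊖ 0)  ≡⟨ ≡.cong fromℤ (ℤ.⊖-≥ {m} z≤n) ⟩
    m · 1#           ≈⟨ +-identityʳ _ ⟨
    m · 1# + 0#      ≈⟨ +-congˡ -0#≈0# ⟨
    m · 1# - 0#      ∎
  fromℤ-⊖ zero    (suc n) = sym (+-identityˡ _)
  fromℤ-⊖ (suc m) (suc n) = begin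
    fromℤ (suc m ℤ.⊖ suc n)    ≡⟨ ≡.cong fromℤ (ℤ.[1+m]⊖[1+n]≡m⊖n m n) ⟩
    fromℤ (m ℤ.⊖ n)            ≈⟨ fromℤ-⊖ m n ⟩
    m · 1# - n · 1#            ≈⟨ [x+y]-[x+z]≈y-z 1# _ _ ⟨
    suc m · 1# - suc n · 1#    ∎

  fromℤ-+ : ∀ a b → fromℤ (a ℤ.+ b) ≈ fromℤ a + fromℤ b
  fromℤ-+ (+ m)    (+ n)    = ·-homo-+ 1# m n
  fromℤ-+ (+ m)    -[1+ n ] = fromℤ-⊖ m (suc n)
  fromℤ-+ -[1+ m ] (+ n)    = trans (fromℤ-⊖ n (suc m)) (+-comm _ _)
  fromℤ-+ -[1+ m ] -[1+ n ] = begin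
    - (suc (suc (m ℕ.+ n)) · 1#)       ≡⟨ ≡.cong (λ k → - (suc k · 1#)) (≡.sym (ℕ.+-suc m n)) ⟩
    - ((suc m ℕ.+ suc n) · 1#)         ≈⟨ -‿cong (·-homo-+ 1# (suc m) (suc n)) ⟩
    - (suc m · 1# + suc n · 1#)        ≈⟨ -‿+-comm _ _ ⟨
    - (suc m · 1#) + - (suc n · 1#)    ∎

  fromℤ-*-+ : ∀ m b → fromℤ (+ m ℤ.* b) ≈ m · 1# * fromℤ b
  fromℤ-*-+ m (+ n)    = trans (reflexive (≡.cong fromℤ (≡.sym (ℤ.pos-* m n)))) (×1-homo-* m n)
  fromℤ-*-+ m -[1+ n ] = begin
    fromℤ (+ m ℤ.* -[1+ n ])         ≡⟨ ≡.cong fromℤ (ℤ.neg-distribʳ-* (+ m) (+ suc n)) ⟨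
    fromℤ (ℤ.- (+ m ℤ.* + suc n))    ≈⟨ fromℤ-neg (+ m ℤ.* + suc n) ⟩
    - fromℤ (+ m ℤ.* + suc n)        ≈⟨ -‿cong (fromℤ-*-+ m (+ suc n)) ⟩
    - (m · 1# * suc n · 1#)          ≈⟨ -‿distribʳ-* _ _ ⟩
    m · 1# * fromℤ -[1+ n ]          ∎

  fromℤ-* : ∀ a b → fromℤ (a ℤ.* b) ≈ fromℤ a * fromℤ b
  fromℤ-* (+ m)    b = fromℤ-*-+ m b
  fromℤ-* -[1+ m ] b = begin
    fromℤ (-[1+ m ] ℤ.* b)         ≡⟨ ≡.cong fromℤ (ℤ.neg-distribˡ-* (+ suc m) b) ⟨
    fromℤ (ℤ.- (+ suc m ℤ.* b))    ≈⟨ fromℤ-neg (+ suc m ℤ.* b) ⟩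
    - fromℤ (+ suc m ℤ.* b)        ≈⟨ -‿cong (fromℤ-*-+ (suc m) b) ⟩
    - (suc m · 1# * fromℤ b)       ≈⟨ -‿distribˡ-* _ _ ⟩
    fromℤ -[1+ m ] * fromℤ b       ∎

  fromℤ-1 : fromℤ 1ℤ ≈ 1#
  fromℤ-1 = +-identityʳ 1#

  fromℤ-^ : ∀ a n → fromℤ (a ℤ.^ n) ≈ fromℤ a ^ n
  fromℤ-^ a zero    = fromℤ-1
  fromℤ-^ a (suc n) = trans (fromℤ-* a (a ℤ.^ n)) (*-congˡ (fromℤ-^ a n))

  private
    open Mult′ semiring using (×ᵤ≈×) renaming (_×_ to _·′_)

    -- Unlike fromℤ, this one sends 0 and 1 to 0# and 1# definitionally, so that
    -- the solver's constants match those of the goals.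
    ⟦_⟧ℤ : ℤ → Carrier
    ⟦ + n ⟧ℤ      = n ·′ 1#
    ⟦ -[1+ n ] ⟧ℤ = - (suc n ·′ 1#)

    ⟦⟧≈fromℤ : ∀ a → ⟦ a ⟧ℤ ≈ fromℤ a
    ⟦⟧≈fromℤ (+ n)    = sym (×ᵤ≈× n 1#)
    ⟦⟧≈fromℤ -[1+ n ] = -‿cong (sym (×ᵤ≈× (suc n) 1#))

    morphism : ℤ.+-*-rawRing -Raw-AlmostCommutative⟶ fromCommutativeRing
      (HeytingCommutativeRing.commutativeRing heytingCommutativeRing)
    morphism = record
      { ⟦_⟧    = ⟦_⟧ℤ
      ; +-homo = λ a b → trans (⟦⟧≈fromℤ (a ℤ.+ b)) (trans (fromℤ-+ a b)
                   (sym (+-cong (⟦⟧≈fromℤ a) (⟦⟧≈fromℤ b))))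
      ; *-homo = λ a b → trans (⟦⟧≈fromℤ (a ℤ.* b)) (trans (fromℤ-* a b)
                   (sym (*-cong (⟦⟧≈fromℤ a) (⟦⟧≈fromℤ b))))
      ; -‿homo = λ a → trans (⟦⟧≈fromℤ (ℤ.- a)) (trans (fromℤ-neg a) (sym (-‿cong (⟦⟧≈fromℤ a))))
      ; 0-homo = refl
      ; 1-homo = refl
      }

    _coeff≟_ : ∀ a b → Maybe (⟦ a ⟧ℤ ≈ ⟦ b ⟧ℤ)
    a coeff≟ b with a ℤ.≟ b
    ... | yes a≡b = just (reflexive (≡.cong ⟦_⟧ℤ a≡b))
    ... | no  _   = nothing

  open RingSolver ℤ.+-*-rawRing _ morphism _coeff≟_ public
    using (solve; con; _:=_; _:+_; _:*_; _:-_; :-_)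

  x*yz≈y*xz : ∀ x y z → x * (y * z) ≈ y * (x * z)
  x*yz≈y*xz = solve 3 (λ x y z → x :* (y :* z) := y :* (x :* z)) refl

-- Integrality by means of stable finitely generated modules.

module Integrality {c ℓ₁ ℓ₂} (Q̄ : AlgebraicNumbers c ℓ₁ ℓ₂) where

  open FieldProperties Q̄
  open Membership setoid using (_∈_)

  -- The ℤ-submodule generated by `G`. As an inductive family it allows induction on how an element
  -- is built, with no indexed sums.
  data ⟨_⟩ {p} (G : Pred Carrier p) : Pred Carrier (c ⊔ ℓ₁ ⊔ p) where
    incl : ∀ {x} → G x → ⟨ G ⟩ x
    nil  : ⟨ G ⟩ 0#
    _⊕_  : ∀ {x y} → ⟨ G ⟩ x → ⟨ G ⟩ y → ⟨ G ⟩ (x + y)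
    ⊖_   : ∀ {x} → ⟨ G ⟩ x → ⟨ G ⟩ (- x)
    cast : ∀ {x y} → x ≈ y → ⟨ G ⟩ x → ⟨ G ⟩ y

  private variable
    p q r : Level
    G : Pred Carrier p
    H : Pred Carrier q
    I : Pred Carrier r

  span-scale : ∀ {a b} → (∀ {g} → G g → ⟨ H ⟩ (a * g)) → ⟨ G ⟩ b → ⟨ H ⟩ (a * b)
  span-scale f (incl g)   = f g
  span-scale f nil        = cast (sym (zeroʳ _)) nil
  span-scale f (s ⊕ t)    = cast (sym (distribˡ _ _ _)) (span-scale f s ⊕ span-scale f t)
  span-scale f (⊖ s)      = cast (-‿distribʳ-* _ _) (⊖ span-scale f s)
  span-scale f (cast e s) = cast (*-congˡ e) (span-scale f s)

  span-bind : ∀ {b} → (∀ {g} → G g → ⟨ H ⟩ g) → ⟨ G ⟩ b → ⟨ H ⟩ b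
  span-bind f (incl g)   = f g
  span-bind f nil        = nil
  span-bind f (s ⊕ t)    = span-bind f s ⊕ span-bind f t
  span-bind f (⊖ s)      = ⊖ span-bind f s
  span-bind f (cast e s) = cast e (span-bind f s)

  span-* : ∀ {a b} → (∀ {g h} → G g → H h → ⟨ I ⟩ (g * h)) → ⟨ G ⟩ a → ⟨ H ⟩ b → ⟨ I ⟩ (a * b)
  span-* f s t = cast (*-comm _ _)
    (span-scale (λ g → cast (*-comm _ _) (span-scale (f g) t)) s)

  span-· : ∀ {g} → ⟨ G ⟩ g → ∀ n → ⟨ G ⟩ (n · 1# * g)
  span-· s zero    = cast (sym (zeroˡ _)) nil
  span-· s (suc n) = cast (sym (trans (distribʳ _ _ _) (+-congʳ (*-identityˡ _)))) (s ⊕ span-· s n)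

  span-fromℤ : ∀ {g} → ⟨ G ⟩ g → ∀ a → ⟨ G ⟩ (fromℤ a * g)
  span-fromℤ s (+ n)    = span-· s n
  span-fromℤ s -[1+ n ] = cast (-‿distribˡ-* _ _) (⊖ span-· s (suc n))

  infixr 7 _⊗_
  -- Generators of the product of two modules. It is stable under whatever stabilises one of the
  -- factors.
  _⊗_ : List Carrier → List Carrier → List Carrier
  _⊗_ = cartesianProductWith _*_

  ∈-⊗⁺ : ∀ {u v V W} → u ∈ V → v ∈ W → u * v ∈ V ⊗ W
  ∈-⊗⁺ = ∈.∈-cartesianProductWith⁺ setoid setoid setoid *-cong

  ∈-⊗⁻ : ∀ {V W x} → x ∈ V ⊗ W → ∃[ u ] ∃[ v ] (u ∈ V × v ∈ W × x ≈ u * v)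
  ∈-⊗⁻ {V} {W} = ∈.∈-cartesianProductWith⁻ setoid setoid setoid _*_ V W

  1∈⊗ : ∀ {V W} → 1# ∈ V → 1# ∈ W → 1# ∈ V ⊗ W
  1∈⊗ 1∈V 1∈W = ∈.∈-resp-≈ setoid (*-identityˡ 1#) (∈-⊗⁺ 1∈V 1∈W)

  Stabilises : List Carrier → Pred Carrier (c ⊔ ℓ₁)
  Stabilises V x = ∀ {v} → v ∈ V → ⟨ _∈ V ⟩ (x * v)

  module _ {V : List Carrier} where

    stabilises-resp : ∀ {x y} → x ≈ y → Stabilises V x → Stabilises V y
    stabilises-resp e s v∈V = cast (*-congʳ e) (s v∈V)

    stabilises-+ : ∀ {x y} → Stabilises V x → Stabilises V y → Stabilises V (x + y)
    stabilises-+ s t v∈V = cast (sym (distribʳ _ _ _)) (s v∈V ⊕ t v∈V)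

    stabilises-* : ∀ {x y} → Stabilises V x → Stabilises V y → Stabilises V (x * y)
    stabilises-* s t v∈V = cast (sym (*-assoc _ _ _)) (span-scale s (t v∈V))

    stabilises-neg : ∀ {x} → Stabilises V x → Stabilises V (- x)
    stabilises-neg s v∈V = cast (-‿distribˡ-* _ _) (⊖ s v∈V)

    stabilises-⊗ˡ : ∀ {W x} → Stabilises V x → Stabilises (V ⊗ W) x
    stabilises-⊗ˡ s v∈ with ∈-⊗⁻ {V} v∈
    ... | u , w , u∈V , w∈W , e = cast (trans (*-assoc _ _ _) (*-congˡ (sym e)))
      (cast (*-comm _ _) (span-scale (λ g∈V → cast (*-comm _ _) (incl (∈-⊗⁺ g∈V w∈W))) (s u∈V)))

    stabilises-⊗ʳ : ∀ {W x} → Stabilises V x → Stabilises (W ⊗ V) x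
    stabilises-⊗ʳ {W} s v∈ with ∈-⊗⁻ {W} v∈
    ... | w , u , w∈W , u∈V , e = cast (trans (x*yz≈y*xz _ _ _) (*-congˡ (sym e)))
      (span-scale (λ g∈V → incl (∈-⊗⁺ w∈W g∈V)) (s u∈V))

  -- Integrality over ℤ in the guise of a finitely generated ℤ-module containing
  -- 1# and stable under multiplication by x.
  Int : Pred Carrier (c ⊔ ℓ₁)
  Int x = ∃[ V ] (1# ∈ V × Stabilises V x)

  Int-resp : ∀ {x y} → x ≈ y → Int x → Int y
  Int-resp e (V , 1∈V , s) = V , 1∈V , stabilises-resp e s

  -- Both elements stabilise the product module `V ⊗ W`, and the elements stabilising a module form
  -- a ring.
  Int-+ : ∀ {x y} → Int x → Int y → Int (x + y)
  Int-+ (V , 1∈V , s) (W , 1∈W , t) =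
    V ⊗ W , 1∈⊗ 1∈V 1∈W , stabilises-+ (stabilises-⊗ˡ s) (stabilises-⊗ʳ {W = V} t)

  Int-* : ∀ {x y} → Int x → Int y → Int (x * y)
  Int-* (V , 1∈V , s) (W , 1∈W , t) =
    V ⊗ W , 1∈⊗ 1∈V 1∈W , stabilises-* (stabilises-⊗ˡ s) (stabilises-⊗ʳ {W = V} t)

  Int-neg : ∀ {x} → Int x → Int (- x)
  Int-neg (V , 1∈V , s) = V , 1∈V , stabilises-neg s

  Int-fromℤ : ∀ a → Int (fromℤ a)
  Int-fromℤ a = [ 1# ] , here refl , λ v∈ → span-fromℤ (incl v∈) a

  Int-0 : Int 0#
  Int-0 = Int-fromℤ 0ℤ

  Int-1 : Int 1#
  Int-1 = Int-resp fromℤ-1 (Int-fromℤ 1ℤ)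

  Int-^ : ∀ {x} n → Int x → Int (x ^ n)
  Int-^ zero    s = Int-1
  Int-^ (suc n) s = Int-* s (Int-^ n s)

  Int-span : ∀ {x} → (∀ {g} → G g → Int g) → ⟨ G ⟩ x → Int x
  Int-span f (incl g)   = f g
  Int-span f nil        = Int-0
  Int-span f (s ⊕ t)    = Int-+ (Int-span f s) (Int-span f t)
  Int-span f (⊖ s)      = Int-neg (Int-span f s)
  Int-span f (cast e s) = Int-resp e (Int-span f s)

  -- From stable modules to monic equations by elimination.

  PowerBelow : Carrier → ℕ → Pred Carrier ℓ₁
  PowerBelow x d y = ∃[ i ] (i < d × y ≈ x ^ i)

  -- Combinations of `1# ∷ W` with coefficients polynomial in `x` of degree below `d`. Keeping `1#`
  -- apart from `W` lets elimination empty `W` and end with plain powers of `x`.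
  PowerMultiple : Carrier → ℕ → List Carrier → Pred Carrier (c ⊔ ℓ₁)
  PowerMultiple x d W y = ∃[ i ] ∃[ w ] (i < d × w ∈ 1# ∷ W × y ≈ x ^ i * w)

  module _ {x : Carrier} where

    power-*-multiple : ∀ {d e W a b} → ⟨ PowerBelow x d ⟩ a → ⟨ PowerMultiple x e W ⟩ b →
                       ⟨ PowerMultiple x (d ℕ.+ e) W ⟩ (a * b)
    power-*-multiple = span-* λ where
      (i , i<d , g≈) (j , w , j<e , w∈W , h≈) → incl (i ℕ.+ j , w , ℕ.+-mono-<-≤ i<d (ℕ.<⇒≤ j<e) , w∈W ,
        trans (*-cong g≈ h≈) (trans (sym (*-assoc _ _ _)) (*-congʳ (sym (^-homo-* x i j)))))

    power-shift : ∀ d {e W b} → ⟨ PowerMultiple x e W ⟩ b → ⟨ PowerMultiple x (d ℕ.+ e) W ⟩ (x ^ d * b)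
    power-shift d = span-scale λ where
      (j , w , j<e , w∈W , h≈) → incl (d ℕ.+ j , w , ℕ.+-monoʳ-< d j<e , w∈W ,
        trans (*-congˡ h≈) (trans (sym (*-assoc _ _ _)) (*-congʳ (sym (^-homo-* x d j)))))

    -- Collects the terms that contain `w`, so that `a` is the coefficient of the unknown to be
    -- eliminated next.
    splitHead : ∀ {d w W y} → ⟨ PowerMultiple x d (w ∷ W) ⟩ y →
                ∃[ a ] ∃[ b ] (⟨ PowerBelow x d ⟩ a × ⟨ PowerMultiple x d W ⟩ b × y ≈ a * w + b)
    splitHead (incl (i , v , i<d , here v≈ , y≈)) =
      0# , _ , nil , incl (i , v , i<d , here v≈ , refl) ,
      trans y≈ (sym (trans (+-congʳ (zeroˡ _)) (+-identityˡ _)))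
    splitHead (incl (i , v , i<d , there (here v≈) , y≈)) =
      x ^ i , 0# , incl (i , i<d , refl) , nil , trans y≈ (trans (*-congˡ v≈) (sym (+-identityʳ _)))
    splitHead (incl (i , v , i<d , there (there v∈) , y≈)) =
      0# , _ , nil , incl (i , v , i<d , there v∈ , refl) ,
      trans y≈ (sym (trans (+-congʳ (zeroˡ _)) (+-identityˡ _)))
    splitHead nil = 0# , 0# , nil , nil , sym (trans (+-congʳ (zeroˡ _)) (+-identityˡ _))
    splitHead (s ⊕ t) with splitHead s | splitHead t
    ... | a , b , s₁ , s₂ , e | a′ , b′ , t₁ , t₂ , e′ =
      a + a′ , b + b′ , s₁ ⊕ t₁ , s₂ ⊕ t₂ , trans (+-cong e e′)
        (solve 5 (λ a b a′ b′ w → a :* w :+ b :+ (a′ :* w :+ b′) := (a :+ a′) :* w :+ (b :+ b′))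
          refl a b a′ b′ _)
    splitHead (⊖ s) with splitHead s
    ... | a , b , s₁ , s₂ , e = - a , - b , ⊖ s₁ , ⊖ s₂ , trans (-‿cong e)
        (solve 3 (λ a b w → :- (a :* w :+ b) := (:- a) :* w :+ :- b) refl a b _)
    splitHead (cast e s) with splitHead s
    ... | a , b , s₁ , s₂ , e′ = a , b , s₁ , s₂ , trans (sym e) e′

    -- The relations say that (x ^ d · Id − A) · (1 ∷ W) = 0 for a matrix A of
    -- polynomials in x of degree < d.  Eliminating the head of W preserves this
    -- shape, with d doubled, so no determinant is needed to reach W = [].
    eliminate : ∀ W d → (∀ {u} → u ∈ 1# ∷ W → ⟨ PowerMultiple x d W ⟩ (x ^ d * u)) →
                ∃[ D ] ⟨ PowerBelow x D ⟩ (x ^ D)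
    eliminate [] d rel = d , cast (*-identityʳ _) (span-bind single (rel (here refl)))
      where
      single : ∀ {y} → PowerMultiple x d [] y → ⟨ PowerBelow x d ⟩ y
      single (i , w , i<d , here w≈1 , y≈) = incl (i , i<d , trans y≈ (trans (*-congˡ w≈1) (*-identityʳ _)))
    eliminate (w ∷ W) d rel with splitHead (rel (there (here refl)))
    ... | a , b , a-low , b-low , xw≈ = eliminate W (d ℕ.+ d) rel′
      where
      -- Multiplying `X * u ≈ a′ * w + b′` by `X - a` removes `w`, because `(X - a) * w ≈ b`; the
      -- result is solved for `X * X * u`.
      identity : ∀ X a a′ b b′ w u → X * w ≈ a * w + b → X * u ≈ a′ * w + b′ →
                 a * (X * u) + (a′ * b + (X * b′ - a * b′)) ≈ X * X * u
      identity X a a′ b b′ w u Xw≈ Xu≈ = begin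
        a * (X * u) + (a′ * b + (X * b′ - a * b′))
          ≈⟨ +-congʳ (*-congˡ Xu≈) ⟩
        a * (a′ * w + b′) + (a′ * b + (X * b′ - a * b′))
          ≈⟨ solve 6 (λ X a a′ b b′ w → a :* (a′ :* w :+ b′) :+ (a′ :* b :+ (X :* b′ :- a :* b′))
               := a′ :* (a :* w :+ b) :+ X :* b′) refl X a a′ b b′ w ⟩
        a′ * (a * w + b) + X * b′
          ≈⟨ +-congʳ (*-congˡ Xw≈) ⟨
        a′ * (X * w) + X * b′
          ≈⟨ solve 4 (λ X a′ b′ w → a′ :* (X :* w) :+ X :* b′ := X :* (a′ :* w :+ b′)) refl X a′ b′ w ⟩
        X * (a′ * w + b′)
          ≈⟨ *-congˡ Xu≈ ⟨
        X * (X * u)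
          ≈⟨ *-assoc X X u ⟨
        X * X * u ∎

      rel′ : ∀ {u} → u ∈ 1# ∷ W → ⟨ PowerMultiple x (d ℕ.+ d) W ⟩ (x ^ (d ℕ.+ d) * u)
      rel′ {u} u∈ with splitHead (rel (skip u∈))
        where
        skip : u ∈ 1# ∷ W → u ∈ 1# ∷ w ∷ W
        skip (here e)  = here e
        skip (there e) = there (there e)
      ... | a′ , b′ , a′-low , b′-low , xu≈ =
        cast (trans (identity (x ^ d) a a′ b b′ w u xw≈ xu≈) (*-congʳ (sym (^-homo-* x d d))))
          (span-scale₂ a-low ⊕ (power-*-multiple a′-low b-low ⊕
            (power-shift d b′-low ⊕ (⊖ power-*-multiple a-low b′-low))))
        where
        span-scale₂ : ∀ {a} → ⟨ PowerBelow x d ⟩ a → ⟨ PowerMultiple x (d ℕ.+ d) W ⟩ (a * (x ^ d * u))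
        span-scale₂ s = cast (*-comm _ _) (span-scale (λ where
          (i , i<d , g≈) → incl (d ℕ.+ i , u , ℕ.+-monoʳ-< d i<d , u∈ , (begin
            x ^ d * u * _        ≈⟨ *-congˡ g≈ ⟩
            x ^ d * u * x ^ i    ≈⟨ solve 3 (λ p u q → p :* u :* q := p :* q :* u) refl _ _ _ ⟩
            x ^ d * x ^ i * u    ≈⟨ *-congʳ (^-homo-* x d i) ⟨
            x ^ (d ℕ.+ i) * u    ∎))) s)

  -- Stability of `V` is a system of relations `x * u = ...` with constant coefficients, that is,
  -- the input of `eliminate` with `d = 1`.
  Int⇒monic : ∀ {x} → Int x → ∃[ D ] ⟨ PowerBelow x (suc D) ⟩ (x ^ suc D)
  Int⇒monic {x} (V , 1∈V , s) with eliminate {x} V 1 rel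
    where
    embed : ∀ {y} → y ∈ V → PowerMultiple x 1 V y
    embed y∈ = 0 , _ , s≤s z≤n , there y∈ , sym (*-identityˡ _)

    rel : ∀ {u} → u ∈ 1# ∷ V → ⟨ PowerMultiple x 1 V ⟩ (x ^ 1 * u)
    rel (here u≈1)  = cast (*-cong (sym (*-identityʳ x)) (sym u≈1)) (span-bind (λ y∈ → incl (embed y∈)) (s 1∈V))
    rel (there u∈V) = cast (*-congʳ (sym (*-identityʳ x))) (span-bind (λ y∈ → incl (embed y∈)) (s u∈V))
  -- One more factor `x` makes the degree of the equation visibly positive, which the divisibility
  -- argument in `Int-rational` relies on.
  ... | D , t = D , span-scale (λ where
    (i , i<D , g≈) → incl (suc i , s≤s i<D , *-congˡ g≈)) t

  -- Transitivity of integrality.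

  CoefficientMultiple : Pred Carrier p → Carrier → ℕ → Pred Carrier (c ⊔ ℓ₁ ⊔ p)
  CoefficientMultiple A z d y = ∃[ i ] ∃[ b ] (i < d × A b × y ≈ b * z ^ i)

  private
    -- Only finitely many coefficients occur, and the product of their modules is stable under each
    -- of them.
    commonModule : ∀ {z d y} → ⟨ CoefficientMultiple Int z d ⟩ y →
                   ∃[ V ] (1# ∈ V × ⟨ CoefficientMultiple (Stabilises V) z d ⟩ y)
    commonModule (incl (i , b , i<d , (V , 1∈V , s) , y≈)) = V , 1∈V , incl (i , b , i<d , s , y≈)
    commonModule nil = [ 1# ] , here refl , nil
    commonModule (s ⊕ t) with commonModule s | commonModule t
    ... | V , 1∈V , s′ | W , 1∈W , t′ = V ⊗ W , 1∈⊗ 1∈V 1∈W ,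
      (span-bind (λ where (i , b , i<d , f , y≈) → incl (i , b , i<d , stabilises-⊗ˡ f , y≈)) s′ ⊕
       span-bind (λ where (i , b , i<d , f , y≈) → incl (i , b , i<d , stabilises-⊗ʳ {W = V} f , y≈)) t′)
    commonModule (⊖ s) with commonModule s
    ... | V , 1∈V , s′ = V , 1∈V , ⊖ s′
    commonModule (cast e s) with commonModule s
    ... | V , 1∈V , s′ = V , 1∈V , cast e s′

  -- The product of the common module with the powers of `z` up to `z ^ d` is stable under `z`:
  -- lower powers move up by one, and the top one is rewritten by the given equation.
  Int-trans : ∀ {z d} → ⟨ CoefficientMultiple Int z (suc d) ⟩ (z ^ suc d) → Int z
  Int-trans {z} {d} s with commonModule s
  ... | V , 1∈V , t = V ⊗ P , 1∈⊗ 1∈V (∈.∈-applyUpTo⁺ setoid (z ^_) {0} (s≤s z≤n)) , stable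
    where
    P : List Carrier
    P = applyUpTo (z ^_) (suc d)

    stable : Stabilises (V ⊗ P) z
    stable v∈ with ∈-⊗⁻ {V} v∈
    ... | u , w , u∈V , w∈P , v≈ with ∈.∈-applyUpTo⁻ setoid (z ^_) {suc d} w∈P
    ... | i , i<n , w≈ with ℕ.m≤n⇒m<n∨m≡n i<n
    ... | inj₁ si<n = cast (sym (trans (*-congˡ (trans v≈ (*-congˡ w≈))) (x*yz≈y*xz _ _ _)))
      (incl (∈-⊗⁺ u∈V (∈.∈-applyUpTo⁺ setoid (z ^_) si<n)))
    ... | inj₂ ≡.refl = cast (sym (trans (*-congˡ (trans v≈ (*-congˡ w≈))) (x*yz≈y*xz _ _ _)))
      (span-scale (λ where
        (j , b , j<n , f , g≈) → cast (*-congˡ (sym g≈)) (cast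
          (solve 3 (λ p b u → p :* (b :* u) := u :* (b :* p)) refl (z ^ j) b u)
          (span-scale {a = z ^ j} (λ v∈V → cast (*-comm _ _)
            (incl (∈-⊗⁺ v∈V (∈.∈-applyUpTo⁺ setoid (z ^_) j<n)))) (f u∈V)))) t)

-- Divisibility of powers, and fractions in lowest terms.

coprime-divisor-^ : ∀ {m n o} k → Coprime m n → m ∣ n ℕ.^ k ℕ.* o → m ∣ o
coprime-divisor-^ {o = o} zero    m⊥n m∣ = ≡.subst (_ ∣_) (ℕ.*-identityˡ o) m∣
coprime-divisor-^ {m} {n} {o} (suc k) m⊥n m∣ = coprime-divisor-^ k m⊥n
  (Coprimality.coprime-divisor m⊥n (≡.subst (m ∣_) (ℕ.*-assoc n (n ℕ.^ k) o) m∣))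

coprime-^ : ∀ {m n} k → Coprime m n → Coprime m (n ℕ.^ k)
coprime-^ {m} {n} k m⊥n (d∣m , d∣n^k) = ∣1⇒≡1 (coprime-divisor-^ k d⊥n
  (≡.subst (_ ∣_) (≡.sym (ℕ.*-identityʳ (n ℕ.^ k))) d∣n^k))
  where
  d⊥n : Coprime _ n
  d⊥n (e∣d , e∣n) = m⊥n (∣-trans e∣d d∣m , e∣n)

^<2^⇒≡1 : ∀ {m} N → m ≢ 0 → m ℕ.^ N < 2 ℕ.^ N → m ≡ 1
^<2^⇒≡1 {zero}        N m≢0 _ = ⊥-elim (m≢0 ≡.refl)
^<2^⇒≡1 {suc zero}    N _ _ = ≡.refl
^<2^⇒≡1 {suc (suc m)} N _ m^N<2^N = ⊥-elim (ℕ.<⇒≱ m^N<2^N (ℕ.^-monoˡ-≤ N (s≤s (s≤s z≤n))))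

abs-^ : ∀ a n → ℤ.∣ a ℤ.^ n ∣ ≡ ℤ.∣ a ∣ ℕ.^ n
abs-^ a zero    = ≡.refl
abs-^ a (suc n) = ≡.trans (ℤ.abs-* a (a ℤ.^ n)) (≡.cong (ℤ.∣ a ∣ ℕ.*_) (abs-^ a n))

lowestTerms : ∀ b c → b ≢ 0ℤ → ∃[ g ] ∃[ b′ ] ∃[ c′ ]
              (g ≢ 0ℤ × b ≡ b′ ℤ.* g × c ≡ c′ ℤ.* g × Coprime ℤ.∣ b′ ∣ ℤ.∣ c′ ∣)
lowestTerms b c b≢0
  with ℤ∣.∣ᵤ⇒∣ {+ gcd ℤ.∣ b ∣ ℤ.∣ c ∣} {b} (gcd[m,n]∣m ℤ.∣ b ∣ ℤ.∣ c ∣)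
     | ℤ∣.∣ᵤ⇒∣ {+ gcd ℤ.∣ b ∣ ℤ.∣ c ∣} {c} (gcd[m,n]∣n ℤ.∣ b ∣ ℤ.∣ c ∣)
... | ℤ∣.divides b′ b≡ | ℤ∣.divides c′ c≡ = + g , b′ , c′ , g≢0 , b≡ , c≡ , coprime
  where
  g = gcd ℤ.∣ b ∣ ℤ.∣ c ∣

  g≢0 : + g ≢ 0ℤ
  g≢0 e = b≢0 (ℤ.∣i∣≡0⇒i≡0 (gcd[m,n]≡0⇒m≡0 {n = ℤ.∣ c ∣} (ℤ.+-injective e)))

  instance
    g-nonZero : ℕ.NonZero g
    g-nonZero = ℕ.≢-nonZero (λ e → g≢0 (≡.cong +_ e))

  scaled : ∀ {a i} a′ → a ≡ a′ ℤ.* + g → i ∣ ℤ.∣ a′ ∣ → i ℕ.* g ∣ ℤ.∣ a ∣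
  scaled a′ ≡.refl i∣a′ = ≡.subst (_ ∣_) (≡.sym (ℤ.abs-* a′ (+ g))) (*-monoˡ-∣ g i∣a′)

  coprime : Coprime ℤ.∣ b′ ∣ ℤ.∣ c′ ∣
  coprime {i} (i∣b′ , i∣c′) = ∣1⇒≡1 (*-cancelʳ-∣ g
    (≡.subst (i ℕ.* g ∣_) (≡.sym (ℕ.*-identityˡ g)) (gcd-greatest (scaled b′ b≡ i∣b′) (scaled c′ c≡ i∣c′))))

-- Rational elements and their denominators.

module Rationals {c ℓ₁ ℓ₂} (Q̄ : AlgebraicNumbers c ℓ₁ ℓ₂) where

  open FieldProperties Q̄
  open Integrality Q̄

  ≉0⇒# : ∀ {x} → ¬ x ≈ 0# → x # 0#
  ≉0⇒# {x} x≉0 with x #? 0#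
  ... | yes x#0 = x#0
  ... | no ¬x#0 = ⊥-elim (x≉0 (proj₁ (tight _ _) ¬x#0))

  #0⇒inverse : ∀ {x} → x # 0# → ∃[ y ] y * x ≈ 1#
  #0⇒inverse x#0 with #⇒invertible x#0
  ... | y , yx≈1 , _ = y , trans (*-congˡ (sym (trans (+-congˡ -0#≈0#) (+-identityʳ _)))) yx≈1

  #0⇒≉0 : ∀ {x} → x # 0# → ¬ x ≈ 0#
  #0⇒≉0 x#0 x≈0 = #-irrefl x≈0 x#0

  1≉0 : ¬ 1# ≈ 0#
  1≉0 1≈0 = characteristicZero 0 (trans (+-identityʳ 1#) 1≈0)

  *-cancel-0 : ∀ {x y} → ¬ x ≈ 0# → x * y ≈ 0# → y ≈ 0#
  *-cancel-0 {x} {y} x≉0 xy≈0 with #0⇒inverse (≉0⇒# x≉0)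
  ... | z , zx≈1 = begin
    y            ≈⟨ *-identityˡ y ⟨
    1# * y       ≈⟨ *-congʳ zx≈1 ⟨
    z * x * y    ≈⟨ *-assoc z x y ⟩
    z * (x * y)  ≈⟨ *-congˡ xy≈0 ⟩
    z * 0#       ≈⟨ zeroʳ z ⟩
    0#           ∎

  *-cancelˡ : ∀ {x y z} → ¬ x ≈ 0# → x * y ≈ x * z → y ≈ z
  *-cancelˡ {x} {y} {z} x≉0 xy≈xz = begin
    y          ≈⟨ solve 2 (λ y z → y := (y :- z) :+ z) refl y z ⟩
    y - z + z  ≈⟨ +-congʳ (*-cancel-0 x≉0 (begin
      x * (y - z)     ≈⟨ solve 3 (λ x y z → x :* (y :- z) := x :* y :- x :* z) refl x y z ⟩
      x * y - x * z   ≈⟨ +-congʳ xy≈xz ⟩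
      x * z - x * z   ≈⟨ -‿inverseʳ _ ⟩
      0#              ∎)) ⟩
    0# + z     ≈⟨ +-identityˡ z ⟩
    z          ∎

  *-≉0 : ∀ {x y} → ¬ x ≈ 0# → ¬ y ≈ 0# → ¬ x * y ≈ 0#
  *-≉0 x≉0 y≉0 xy≈0 = y≉0 (*-cancel-0 x≉0 xy≈0)

  ^-≉0 : ∀ {x} n → ¬ x ≈ 0# → ¬ x ^ n ≈ 0#
  ^-≉0 zero    x≉0 = 1≉0
  ^-≉0 (suc n) x≉0 = *-≉0 x≉0 (^-≉0 n x≉0)

  fromℤ-≉0 : ∀ {a} → a ≢ 0ℤ → ¬ fromℤ a ≈ 0#
  fromℤ-≉0 {+ zero}    a≢0 _ = a≢0 ≡.refl
  fromℤ-≉0 {+ suc n}   _ e = characteristicZero n e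
  fromℤ-≉0 { -[1+ n ]} _ e = characteristicZero n
    (trans (sym (-‿involutive _)) (trans (-‿cong e) -0#≈0#))

  fromℤ-injective : ∀ {a b} → fromℤ a ≈ fromℤ b → a ≡ b
  fromℤ-injective {a} {b} e with a ℤ.- b ℤ.≟ 0ℤ
  ... | yes a-b≡0 = ℤ.i-j≡0⇒i≡j a b a-b≡0
  ... | no  a-b≢0 = ⊥-elim (fromℤ-≉0 a-b≢0 (begin
    fromℤ (a ℤ.- b)            ≈⟨ fromℤ-+ a (ℤ.- b) ⟩
    fromℤ a + fromℤ (ℤ.- b)    ≈⟨ +-cong e (fromℤ-neg b) ⟩
    fromℤ b - fromℤ b          ≈⟨ -‿inverseʳ _ ⟩
    0#                         ∎))

  Integer : Pred Carrier ℓ₁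
  Integer x = ∃[ k ] x ≈ fromℤ k

  unitDenominator : ∀ {b c x} → ℤ.∣ b ∣ ≡ 1 → fromℤ b * x ≈ fromℤ c → Integer x
  unitDenominator {+ 1}      {c} ≡.refl e =
    c , trans (sym (trans (*-congʳ fromℤ-1) (*-identityˡ _))) e
  unitDenominator { -[1+ 0 ]} {c} {x} ≡.refl e = ℤ.- c , (begin
    x                   ≈⟨ solve 1 (λ x → x := :- ((:- con (+ 1)) :* x)) refl x ⟩
    - (- 1# * x)        ≈⟨ -‿cong (*-congʳ (-‿cong fromℤ-1)) ⟨
    - (fromℤ -[1+ 0 ] * x)  ≈⟨ -‿cong e ⟩
    - fromℤ c           ≈⟨ fromℤ-neg c ⟨
    fromℤ (ℤ.- c)       ∎)

  cancelCommonFactor : ∀ {g b c x} → g ≢ 0ℤ → fromℤ (b ℤ.* g) * x ≈ fromℤ (c ℤ.* g) →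
                       fromℤ b * x ≈ fromℤ c
  cancelCommonFactor {g} {b} {c} {x} g≢0 e = *-cancelˡ (fromℤ-≉0 g≢0) (begin
    fromℤ g * (fromℤ b * x)    ≈⟨ solve 3 (λ g b x → g :* (b :* x) := b :* g :* x) refl _ _ _ ⟩
    fromℤ b * fromℤ g * x      ≈⟨ *-congʳ (fromℤ-* b g) ⟨
    fromℤ (b ℤ.* g) * x        ≈⟨ e ⟩
    fromℤ (c ℤ.* g)            ≈⟨ fromℤ-* c g ⟩
    fromℤ c * fromℤ g          ≈⟨ *-comm _ _ ⟩
    fromℤ g * fromℤ c          ∎)

  private
    -- Each of the `i` factors `x` absorbs one factor `b`, leaving `b ^ (d - i) * c ^ i`.
    clear : ∀ {b c x} → fromℤ b * x ≈ fromℤ c → ∀ i d → i ≤ d → Integer (fromℤ b ^ d * x ^ i)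
    clear {b} e zero d z≤n = b ℤ.^ d , trans (*-identityʳ _) (sym (fromℤ-^ b d))
    clear {b} {c} {x} e (suc i) (suc d) (s≤s i≤d) with clear {b} {c} e i d i≤d
    ... | k , e′ = c ℤ.* k , (begin
      fromℤ b * fromℤ b ^ d * (x * x ^ i)
        ≈⟨ solve 4 (λ p q r s → p :* q :* (r :* s) := p :* r :* (q :* s)) refl _ _ _ _ ⟩
      fromℤ b * x * (fromℤ b ^ d * x ^ i)    ≈⟨ *-cong e e′ ⟩
      fromℤ c * fromℤ k                      ≈⟨ fromℤ-* c k ⟨
      fromℤ (c ℤ.* k)                        ∎)

  Integer-span : ∀ {p} {G : Pred Carrier p} {a x} → (∀ {g} → G g → Integer (a * g)) → ⟨ G ⟩ x → Integer (a * x)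
  Integer-span f (incl g) = f g
  Integer-span f nil      = 0ℤ , zeroʳ _
  Integer-span f (s ⊕ t) with Integer-span f s | Integer-span f t
  ... | k , e | l , e′ = k ℤ.+ l , trans (distribˡ _ _ _) (trans (+-cong e e′) (sym (fromℤ-+ k l)))
  Integer-span f (⊖ s) with Integer-span f s
  ... | k , e = ℤ.- k , trans (sym (-‿distribʳ-* _ _)) (trans (-‿cong e) (sym (fromℤ-neg k)))
  Integer-span f (cast e s) with Integer-span f s
  ... | k , e′ = k , trans (*-congˡ (sym e)) e′

  -- The rational root theorem. For `x = c′ / b′` in lowest terms, `b′ ^ D` times the monic equation
  -- of degree `suc D` has only integers on its lower side, so `b′` divides `c′ ^ suc D` and is a
  -- unit.
  Int-rational : ∀ {b c x} → b ≢ 0ℤ → fromℤ b * x ≈ fromℤ c → Int x → Integer x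
  Int-rational {b} {c} {x} b≢0 bx≈c x-int with lowestTerms b c b≢0
  ... | g , b′ , c′ , g≢0 , ≡.refl , ≡.refl , b′⊥c′ with Int⇒monic x-int
  ... | D , s with Integer-span {a = fromℤ b′ ^ D} (λ where
          (i , s≤s i≤D , g≈) → let k , e = clear {b′} {c′} b′x≈c′ i D i≤D in k , trans (*-congˡ g≈) e) s
    where b′x≈c′ = cancelCommonFactor {g} {b′} {c′} g≢0 bx≈c
  ... | k , e = unitDenominator {b′} {c′} (coprime-^ (suc D) b′⊥c′ (∣-refl , b′∣)) b′x≈c′
    where
    b′x≈c′ = cancelCommonFactor {g} {b′} {c′} g≢0 bx≈c

    b′k≡ : b′ ℤ.* k ≡ c′ ℤ.^ suc D
    b′k≡ = fromℤ-injective (begin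
      fromℤ (b′ ℤ.* k)                        ≈⟨ fromℤ-* b′ k ⟩
      fromℤ b′ * fromℤ k                      ≈⟨ *-congˡ e ⟨
      fromℤ b′ * (fromℤ b′ ^ D * x ^ suc D)   ≈⟨ *-assoc _ _ _ ⟨
      fromℤ b′ ^ suc D * x ^ suc D            ≈⟨ ^-distrib-* _ _ (suc D) ⟨
      (fromℤ b′ * x) ^ suc D                  ≈⟨ ^-congˡ (suc D) b′x≈c′ ⟩
      fromℤ c′ ^ suc D                        ≈⟨ fromℤ-^ c′ (suc D) ⟨
      fromℤ (c′ ℤ.^ suc D)                    ∎)

    b′∣ : ℤ.∣ b′ ∣ ∣ ℤ.∣ c′ ∣ ℕ.^ suc D
    b′∣ = divides ℤ.∣ k ∣ (≡.trans (≡.sym (abs-^ c′ (suc D)))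
      (≡.trans (≡.cong ℤ.∣_∣ (≡.sym b′k≡)) (≡.trans (ℤ.abs-* b′ k) (ℕ.*-comm ℤ.∣ b′ ∣ ℤ.∣ k ∣))))

  -- For `x = c′ / b′` in lowest terms the hypothesis gives that `b′ ^ N` divides `c′ ^ N * E`,
  -- hence `E`. Were `b′` not a unit, this power would be at least `2 ^ N`, more than `E` allows.
  bounded-denominator : ∀ {b c x} E N → b ≢ 0ℤ → E ≢ 0ℤ → ℤ.∣ E ∣ < 2 ℕ.^ N →
                        fromℤ b * x ≈ fromℤ c → Integer (fromℤ E * x ^ N) → Integer x
  bounded-denominator {b} {c} {x} E N b≢0 E≢0 E<2^N bx≈c (k , e) with lowestTerms b c b≢0
  ... | g , b′ , c′ , g≢0 , ≡.refl , ≡.refl , b′⊥c′ = unitDenominator {b′} {c′} ∣b′∣≡1 b′x≈c′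
    where
    b′x≈c′ = cancelCommonFactor {g} {b′} {c′} g≢0 bx≈c

    b′^N*k≡ : b′ ℤ.^ N ℤ.* k ≡ c′ ℤ.^ N ℤ.* E
    b′^N*k≡ = fromℤ-injective (begin
      fromℤ (b′ ℤ.^ N ℤ.* k)               ≈⟨ fromℤ-* (b′ ℤ.^ N) k ⟩
      fromℤ (b′ ℤ.^ N) * fromℤ k           ≈⟨ *-cong (fromℤ-^ b′ N) (sym e) ⟩
      fromℤ b′ ^ N * (fromℤ E * x ^ N)
        ≈⟨ solve 3 (λ b e x → b :* (e :* x) := b :* x :* e) refl _ _ _ ⟩
      fromℤ b′ ^ N * x ^ N * fromℤ E       ≈⟨ *-congʳ (^-distrib-* _ _ N) ⟨
      (fromℤ b′ * x) ^ N * fromℤ E         ≈⟨ *-congʳ (^-congˡ N b′x≈c′) ⟩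
      fromℤ c′ ^ N * fromℤ E               ≈⟨ *-congʳ (fromℤ-^ c′ N) ⟨
      fromℤ (c′ ℤ.^ N) * fromℤ E           ≈⟨ fromℤ-* (c′ ℤ.^ N) E ⟨
      fromℤ (c′ ℤ.^ N ℤ.* E)               ∎)

    b′^N∣ : ℤ.∣ b′ ∣ ℕ.^ N ∣ ℤ.∣ c′ ∣ ℕ.^ N ℕ.* ℤ.∣ E ∣
    b′^N∣ = divides ℤ.∣ k ∣ (R.begin
      ℤ.∣ c′ ∣ ℕ.^ N ℕ.* ℤ.∣ E ∣    R.≡⟨ ≡.cong (ℕ._* ℤ.∣ E ∣) (≡.sym (abs-^ c′ N)) ⟩
      ℤ.∣ c′ ℤ.^ N ∣ ℕ.* ℤ.∣ E ∣    R.≡⟨ ≡.sym (ℤ.abs-* (c′ ℤ.^ N) E) ⟩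
      ℤ.∣ c′ ℤ.^ N ℤ.* E ∣          R.≡⟨ ≡.cong ℤ.∣_∣ (≡.sym b′^N*k≡) ⟩
      ℤ.∣ b′ ℤ.^ N ℤ.* k ∣          R.≡⟨ ℤ.abs-* (b′ ℤ.^ N) k ⟩
      ℤ.∣ b′ ℤ.^ N ∣ ℕ.* ℤ.∣ k ∣    R.≡⟨ ≡.cong (ℕ._* ℤ.∣ k ∣) (abs-^ b′ N) ⟩
      ℤ.∣ b′ ∣ ℕ.^ N ℕ.* ℤ.∣ k ∣    R.≡⟨ ℕ.*-comm (ℤ.∣ b′ ∣ ℕ.^ N) ℤ.∣ k ∣ ⟩
      ℤ.∣ k ∣ ℕ.* ℤ.∣ b′ ∣ ℕ.^ N    R.∎)
      where module R = ≡.≡-Reasoning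

    b′^N∣E : ℤ.∣ b′ ∣ ℕ.^ N ∣ ℤ.∣ E ∣
    b′^N∣E = coprime-divisor-^ N (Coprimality.sym (coprime-^ N (Coprimality.sym b′⊥c′))) b′^N∣

    ∣b′∣≡1 : ℤ.∣ b′ ∣ ≡ 1
    ∣b′∣≡1 = ^<2^⇒≡1 N (λ e → b≢0 (≡.cong (ℤ._* g) (ℤ.∣i∣≡0⇒i≡0 {b′} e)))
      (ℕ.≤-<-trans (∣⇒≤ b′^N∣E) E<2^N)
      where instance
        E-nonZero : ℕ.NonZero ℤ.∣ E ∣
        E-nonZero = ℕ.≢-nonZero (λ e → E≢0 (ℤ.∣i∣≡0⇒i≡0 e))

-- Polynomials with integer coefficients, annihilators and pseudo-division.

module Polynomials {c ℓ₁ ℓ₂} (Q̄ : AlgebraicNumbers c ℓ₁ ℓ₂) where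

  open FieldProperties Q̄
  open Integrality Q̄
  open Rationals Q̄

  eval-∷ʳ : ∀ P a y → eval (P ++ [ a ]) y ≈ eval P y + a * y ^ length P
  eval-∷ʳ []      a y = solve 2 (λ a y → a :+ y :* con (+ 0) := con (+ 0) :+ a :* con (+ 1)) refl a y
  eval-∷ʳ (b ∷ P) a y = begin
    b + y * eval (P ++ [ a ]) y                  ≈⟨ +-congˡ (*-congˡ (eval-∷ʳ P a y)) ⟩
    b + y * (eval P y + a * y ^ length P)
      ≈⟨ solve 5 (λ b y e a t → b :+ y :* (e :+ a :* t) := b :+ y :* e :+ a :* (y :* t)) refl _ _ _ _ _ ⟩
    b + y * eval P y + a * (y * y ^ length P)    ∎

  evalℤ-∷ʳ : ∀ P a y → evalℤ (P ++ [ a ]) y ≈ evalℤ P y + fromℤ a * y ^ length P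
  evalℤ-∷ʳ P a y = begin
    evalℤ (P ++ [ a ]) y                                 ≡⟨ ≡.cong (λ l → eval l y) (List.map-++ fromℤ P [ a ]) ⟩
    eval (map fromℤ P ++ [ fromℤ a ]) y                  ≈⟨ eval-∷ʳ (map fromℤ P) (fromℤ a) y ⟩
    evalℤ P y + fromℤ a * y ^ length (map fromℤ P)       ≡⟨ ≡.cong (λ k → evalℤ P y + fromℤ a * y ^ k) (List.length-map fromℤ P) ⟩
    evalℤ P y + fromℤ a * y ^ length P                   ∎

  eval-CoefficientMultiple : ∀ {p} {A : Pred Carrier p} {P} x → All A P →
                             ⟨ CoefficientMultiple A x (length P) ⟩ (eval P x)
  eval-CoefficientMultiple x []       = nil
  eval-CoefficientMultiple x (a ∷ as) =
    incl (0 , _ , s≤s z≤n , a , sym (*-identityʳ _)) ⊕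
    span-scale (λ where
      (i , b , i< , b-int , g≈) → incl (suc i , b , s≤s i< , b-int ,
        trans (*-congˡ g≈) (solve 3 (λ x b t → x :* (b :* t) := b :* (x :* t)) refl _ _ _)))
      (eval-CoefficientMultiple x as)

  x+y≈0⇒y≈-x : ∀ {x y} → x + y ≈ 0# → y ≈ - x
  x+y≈0⇒y≈-x {x} {y} e = begin
    y            ≈⟨ solve 2 (λ x y → y := x :+ y :- x) refl x y ⟩
    x + y - x    ≈⟨ +-congʳ e ⟩
    0# - x       ≈⟨ +-identityˡ _ ⟩
    - x          ∎

  monicRoot-Int : ∀ P x → All Int P → eval P x + x ^ length P ≈ 0# → Int x
  monicRoot-Int []      x _  e = ⊥-elim (1≉0 (trans (sym (+-identityˡ 1#)) e))
  monicRoot-Int (a ∷ P) x as e =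
    Int-trans (cast (sym (x+y≈0⇒y≈-x e)) (⊖ eval-CoefficientMultiple x as))

  IntegralOverℤ⇒Int : ∀ {x} → IntegralOverℤ x → Int x
  IntegralOverℤ⇒Int {x} (P , e) = monicRoot-Int (map fromℤ P) x (All.map⁺ (ints P)) (begin
    evalℤ P x + x ^ length (map fromℤ P)       ≡⟨ ≡.cong (λ k → evalℤ P x + x ^ k) (List.length-map fromℤ P) ⟩
    evalℤ P x + x ^ length P                   ≈⟨ +-congˡ (*-identityˡ _) ⟨
    evalℤ P x + 1# * x ^ length P              ≈⟨ +-congˡ (*-congʳ fromℤ-1) ⟨
    evalℤ P x + fromℤ 1ℤ * x ^ length P        ≈⟨ evalℤ-∷ʳ P 1ℤ x ⟨
    evalℤ (P ++ [ 1ℤ ]) x                      ≈⟨ e ⟩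
    0#                                         ∎)
    where
    ints : ∀ P → All (λ a → Int (fromℤ a)) P
    ints []      = []
    ints (a ∷ P) = Int-fromℤ a ∷ ints P

  -- A vector of length `n` serves as a polynomial of degree below `n`, so that types record the
  -- bound on which the descent runs.
  ⟪_⟫ : ∀ {n} → Vec ℤ n → Carrier → Carrier
  ⟪ v ⟫ = evalℤ (Vec.toList v)

  ⟪⟫-0 : ∀ n y → ⟪ Vec.replicate n 0ℤ ⟫ y ≈ 0#
  ⟪⟫-0 zero    y = refl
  ⟪⟫-0 (suc n) y = trans (+-identityˡ _) (trans (*-congˡ (⟪⟫-0 n y)) (zeroʳ y))

  ⟪⟫-+ : ∀ {n} (u v : Vec ℤ n) y → ⟪ Vec.zipWith ℤ._+_ u v ⟫ y ≈ ⟪ u ⟫ y + ⟪ v ⟫ y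
  ⟪⟫-+ []      []      y = sym (+-identityʳ 0#)
  ⟪⟫-+ (a ∷ u) (b ∷ v) y = trans (+-cong (fromℤ-+ a b) (*-congˡ (⟪⟫-+ u v y)))
    (solve 5 (λ a b y s t → a :+ b :+ y :* (s :+ t) := a :+ y :* s :+ (b :+ y :* t)) refl _ _ _ _ _)

  ⟪⟫-* : ∀ {n} a (v : Vec ℤ n) y → ⟪ Vec.map (a ℤ.*_) v ⟫ y ≈ fromℤ a * ⟪ v ⟫ y
  ⟪⟫-* a []      y = sym (zeroʳ _)
  ⟪⟫-* a (b ∷ v) y = trans (+-cong (fromℤ-* a b) (*-congˡ (⟪⟫-* a v y)))
    (solve 4 (λ a b y s → a :* b :+ y :* (a :* s) := a :* (b :+ y :* s)) refl _ _ _ _)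

  ⟪⟫-neg : ∀ {n} (v : Vec ℤ n) y → ⟪ Vec.map ℤ.-_ v ⟫ y ≈ - ⟪ v ⟫ y
  ⟪⟫-neg []      y = sym -0#≈0#
  ⟪⟫-neg (b ∷ v) y = trans (+-cong (fromℤ-neg b) (*-congˡ (⟪⟫-neg v y)))
    (solve 3 (λ b y s → :- b :+ y :* (:- s) := :- (b :+ y :* s)) refl _ _ _)

  monomial : ∀ {i d} → i < d → Vec ℤ d
  monomial {zero}  {suc d} _         = 1ℤ ∷ Vec.replicate d 0ℤ
  monomial {suc i} {suc d} (s≤s i<d) = 0ℤ ∷ monomial i<d

  ⟪⟫-monomial : ∀ {i d} (i<d : i < d) y → ⟪ monomial i<d ⟫ y ≈ y ^ i
  ⟪⟫-monomial {zero}  {suc d} _         y = trans (+-cong fromℤ-1 (trans (*-congˡ (⟪⟫-0 d y)) (zeroʳ y))) (+-identityʳ 1#)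
  ⟪⟫-monomial {suc i} {suc d} (s≤s i<d) y = trans (+-identityˡ _) (*-congˡ (⟪⟫-monomial i<d y))

  span-PowerBelow⇒⟪⟫ : ∀ {x d y} → ⟨ PowerBelow x d ⟩ y → ∃[ v ] y ≈ ⟪_⟫ {d} v x
  span-PowerBelow⇒⟪⟫ {x} (incl (i , i<d , y≈)) = monomial i<d , trans y≈ (sym (⟪⟫-monomial i<d x))
  span-PowerBelow⇒⟪⟫ {x} {d} nil = Vec.replicate d 0ℤ , sym (⟪⟫-0 d x)
  span-PowerBelow⇒⟪⟫ {x} (s ⊕ t) with span-PowerBelow⇒⟪⟫ s | span-PowerBelow⇒⟪⟫ t
  ... | u , e | v , e′ = Vec.zipWith ℤ._+_ u v , trans (+-cong e e′) (sym (⟪⟫-+ u v x))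
  span-PowerBelow⇒⟪⟫ {x} (⊖ s) with span-PowerBelow⇒⟪⟫ s
  ... | v , e = Vec.map ℤ.-_ v , trans (-‿cong e) (sym (⟪⟫-neg v x))
  span-PowerBelow⇒⟪⟫ (cast e s) with span-PowerBelow⇒⟪⟫ s
  ... | v , e′ = v , trans (sym e) e′

  Int⇒IntegralOverℤ : ∀ {x} → Int x → IntegralOverℤ x
  Int⇒IntegralOverℤ {x} x-int with Int⇒monic x-int
  ... | D , s with span-PowerBelow⇒⟪⟫ s
  ... | v , e = Vec.toList w , (begin
    evalℤ (Vec.toList w ++ [ 1ℤ ]) x                       ≈⟨ evalℤ-∷ʳ (Vec.toList w) 1ℤ x ⟩
    ⟪ w ⟫ x + fromℤ 1ℤ * x ^ length (Vec.toList w)         ≡⟨ ≡.cong (λ k → ⟪ w ⟫ x + fromℤ 1ℤ * x ^ k) (Vec.length-toList w) ⟩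
    ⟪ w ⟫ x + fromℤ 1ℤ * x ^ suc D                         ≈⟨ +-cong (⟪⟫-neg v x) (trans (*-congʳ fromℤ-1) (trans (*-identityˡ _) e)) ⟩
    - ⟪ v ⟫ x + ⟪ v ⟫ x                                    ≈⟨ -‿inverseˡ _ ⟩
    0#                                                     ∎)
    where w = Vec.map ℤ.-_ v

  -- The leading coefficient of `p + a T ^ n` stands apart, so the degree is exactly `n` once
  -- `a ≢ 0ℤ`.
  Root : ∀ {n} → Vec ℤ n → ℤ → Pred Carrier ℓ₁
  Root {n} p a y = ⟪ p ⟫ y + fromℤ a * y ^ n ≈ 0#

  evalℤ-0 : ∀ {l} → All (_≡ 0ℤ) l → ∀ y → evalℤ l y ≈ 0#
  evalℤ-0 []             y = refl
  evalℤ-0 (≡.refl ∷ l≡0) y = trans (+-identityˡ _) (trans (*-congˡ (evalℤ-0 l≡0 y)) (zeroʳ y))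

  -- Strips trailing zeros. The bound `k < length l` is what makes the degree drop in `descend`.
  leading : ∀ (l : List ℤ) → All (_≡ 0ℤ) l ⊎
            ∃[ k ] ∃[ p ] ∃[ a ] (k < length l × a ≢ 0ℤ × ∀ y → evalℤ l y ≈ ⟪_⟫ {k} p y + fromℤ a * y ^ k)
  leading []      = inj₁ []
  leading (b ∷ l) with leading l
  ... | inj₂ (k , p , a , k<l , a≢0 , e) = inj₂ (suc k , b ∷ p , a , s≤s k<l , a≢0 , λ y →
    trans (+-congˡ (*-congˡ (e y)))
      (solve 5 (λ b y s a t → b :+ y :* (s :+ a :* t) := b :+ y :* s :+ a :* (y :* t)) refl _ _ _ _ _))
  ... | inj₁ l≡0 with b ℤ.≟ 0ℤ
  ... | yes b≡0 = inj₁ (b≡0 ∷ l≡0)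
  ... | no  b≢0 = inj₂ (0 , [] , b , s≤s z≤n , b≢0 , λ y → trans (+-congˡ (trans (*-congˡ (evalℤ-0 l≡0 y)) (zeroʳ y)))
      (solve 1 (λ b → b :+ con (+ 0) := con (+ 0) :+ b :* con (+ 1)) refl _))

  algebraic-Root : ∀ x → ∃[ n ] ∃[ p ] ∃[ a ] (a ≢ 0ℤ × Root {n} p a x)
  algebraic-Root x with algebraic x
  ... | l , l≢0 , e with leading l
  ... | inj₁ l≡0 = ⊥-elim (All.All¬⇒¬Any (All.map (λ b≡0 b≢0 → b≢0 b≡0) l≡0) l≢0)
  ... | inj₂ (k , p , a , _ , a≢0 , e′) = k , p , a , a≢0 , trans (sym (e′ x)) e

  -- If `p + a T ^ n` annihilates `x`, then `a * x` satisfies the monic equation whose lower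
  -- coefficients are those of `p` times `a ^ (n - 1 - i)`.
  denominator : ∀ x → ∃[ a ] (a ≢ 0ℤ × Int (fromℤ a * x))
  denominator x with algebraic-Root x
  ... | n , p , a , a≢0 , root = a , a≢0 , monicRoot-Int (scaled p) (fromℤ a * x) (scaled-Int p)
      -- The extra factor `A`, cancelled here, turns the exponent `n - 1` into `n`.
      (*-cancel-0 (fromℤ-≉0 a≢0) (begin
        A * (eval (scaled p) (A * x) + (A * x) ^ length (scaled p))
          ≡⟨ ≡.cong (λ k → A * (eval (scaled p) (A * x) + (A * x) ^ k)) (length-scaled p) ⟩
        A * (eval (scaled p) (A * x) + (A * x) ^ n)
          ≈⟨ distribˡ _ _ _ ⟩
        A * eval (scaled p) (A * x) + A * (A * x) ^ n
          ≈⟨ +-cong (eval-scaled p) (*-congˡ (^-distrib-* A x n)) ⟩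
        A ^ n * ⟪ p ⟫ x + A * (A ^ n * x ^ n)
          ≈⟨ solve 4 (λ t s a z → t :* s :+ a :* (t :* z) := t :* (s :+ a :* z)) refl _ _ _ _ ⟩
        A ^ n * (⟪ p ⟫ x + A * x ^ n)
          ≈⟨ trans (*-congˡ root) (zeroʳ _) ⟩
        0# ∎))
    where
    A = fromℤ a

    scaled : ∀ {n} → Vec ℤ n → List Carrier
    scaled []                = []
    scaled {suc n} (b ∷ p) = fromℤ b * A ^ n ∷ scaled p

    length-scaled : ∀ {n} (p : Vec ℤ n) → length (scaled p) ≡ n
    length-scaled []      = ≡.refl
    length-scaled (b ∷ p) = ≡.cong suc (length-scaled p)

    scaled-Int : ∀ {n} (p : Vec ℤ n) → All Int (scaled p)
    scaled-Int []              = []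
    scaled-Int {suc n} (b ∷ p) = Int-* (Int-fromℤ b) (Int-^ n (Int-fromℤ a)) ∷ scaled-Int p

    eval-scaled : ∀ {n} (p : Vec ℤ n) → A * eval (scaled p) (A * x) ≈ A ^ n * ⟪ p ⟫ x
    eval-scaled []              = solve 1 (λ a → a :* con (+ 0) := con (+ 1) :* con (+ 0)) refl A
    eval-scaled {suc n} (b ∷ p) = begin
      A * (fromℤ b * A ^ n + A * x * eval (scaled p) (A * x))
        ≈⟨ solve 5 (λ a b t x s → a :* (b :* t :+ a :* x :* s) := a :* (b :* t :+ x :* (a :* s))) refl _ _ _ _ _ ⟩
      A * (fromℤ b * A ^ n + x * (A * eval (scaled p) (A * x)))
        ≈⟨ *-congˡ (+-congˡ (*-congˡ (eval-scaled p))) ⟩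
      A * (fromℤ b * A ^ n + x * (A ^ n * ⟪ p ⟫ x))
        ≈⟨ solve 5 (λ a b t x s → a :* (b :* t :+ x :* (t :* s)) := a :* t :* (b :+ x :* s)) refl _ _ _ _ _ ⟩
      A ^ suc n * (fromℤ b + x * ⟪ p ⟫ x) ∎

  -- Reducible φ says that φ is, up to a power of a, congruent to a polynomial of
  -- degree < n modulo p + a T ^ n (pseudo-division).
  module PseudoDivision {n} (p : Vec ℤ n) {a} (a≢0 : a ≢ 0ℤ) where

    Reducible : (Carrier → Carrier) → Set (c ⊔ ℓ₁)
    Reducible φ = ∃[ k ] ∃[ r ] (∀ {y} → Root p a y → fromℤ a ^ k * φ y ≈ ⟪_⟫ {n} r y)

    reducible-ext : ∀ {φ ψ} → (∀ y → φ y ≈ ψ y) → Reducible φ → Reducible ψ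
    reducible-ext e (k , r , f) = k , r , λ root → trans (*-congˡ (sym (e _))) (f root)

    reducible-const : ∀ b → Reducible (λ _ → fromℤ b)
    reducible-const b = 0 , constant p , λ root → trans (*-identityˡ _) (constant-eval p root)
      where
      constant : ∀ {n} → Vec ℤ n → Vec ℤ n
      constant []              = []
      constant (_∷_ {n = n} _ _) = b ∷ Vec.replicate n 0ℤ

      constant-eval : ∀ {n} (p : Vec ℤ n) {y} → Root p a y → fromℤ b ≈ ⟪ constant p ⟫ y
      -- In degree 0 there is no root: the equation would say that `a` vanishes.
      constant-eval [] root = ⊥-elim (fromℤ-≉0 a≢0
        (trans (sym (trans (+-identityˡ _) (*-identityʳ _))) root))
      constant-eval (_∷_ {n = n} _ _) {y} _ = sym (trans (+-congˡ (trans (*-congˡ (⟪⟫-0 n y)) (zeroʳ y))) (+-identityʳ _))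

    reducible-+ : ∀ {φ ψ} → Reducible φ → Reducible ψ → Reducible (λ y → φ y + ψ y)
    reducible-+ {φ} {ψ} (k , r , f) (l , s , g) =
      k ℕ.+ l , Vec.zipWith ℤ._+_ r′ s′ , λ {y} root → begin
        A ^ (k ℕ.+ l) * (φ y + ψ y)                      ≈⟨ *-congʳ (^-homo-* A k l) ⟩
        A ^ k * A ^ l * (φ y + ψ y)
          ≈⟨ solve 4 (λ s t x y → s :* t :* (x :+ y) := t :* (s :* x) :+ s :* (t :* y)) refl _ _ _ _ ⟩
        A ^ l * (A ^ k * φ y) + A ^ k * (A ^ l * ψ y)    ≈⟨ +-cong (*-cong (sym (fromℤ-^ a l)) (f root)) (*-cong (sym (fromℤ-^ a k)) (g root)) ⟩
        fromℤ (a ℤ.^ l) * ⟪ r ⟫ y + fromℤ (a ℤ.^ k) * ⟪ s ⟫ y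
          ≈⟨ +-cong (⟪⟫-* (a ℤ.^ l) r y) (⟪⟫-* (a ℤ.^ k) s y) ⟨
        ⟪ r′ ⟫ y + ⟪ s′ ⟫ y
          ≈⟨ ⟪⟫-+ r′ s′ y ⟨
        ⟪ Vec.zipWith ℤ._+_ r′ s′ ⟫ y ∎
      where
      A = fromℤ a
      r′ = Vec.map (a ℤ.^ l ℤ.*_) r
      s′ = Vec.map (a ℤ.^ k ℤ.*_) s

    reducible-scale : ∀ b {φ} → Reducible φ → Reducible (λ y → fromℤ b * φ y)
    reducible-scale b {φ} (k , r , f) = k , Vec.map (b ℤ.*_) r , λ {y} root → begin
      fromℤ a ^ k * (fromℤ b * φ y)    ≈⟨ solve 3 (λ s t x → s :* (t :* x) := t :* (s :* x)) refl _ _ _ ⟩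
      fromℤ b * (fromℤ a ^ k * φ y)    ≈⟨ *-congˡ (f root) ⟩
      fromℤ b * ⟪ r ⟫ y                ≈⟨ ⟪⟫-* b r y ⟨
      ⟪ Vec.map (b ℤ.*_) r ⟫ y         ∎

    private
      shift : ∀ {n} b (r : Vec ℤ n) → ∃[ s ] ∃[ d ] (∀ y → ⟪ b ∷ r ⟫ y ≈ ⟪_⟫ {n} s y + fromℤ d * y ^ n)
      shift b [] = [] , b , λ y →
        solve 2 (λ b y → b :+ y :* con (+ 0) := con (+ 0) :+ b :* con (+ 1)) refl _ y
      shift b (b′ ∷ r) with shift b′ r
      ... | s , d , e = b ∷ s , d , λ y → trans (+-congˡ (*-congˡ (e y)))
        (solve 5 (λ b y s a t → b :+ y :* (s :+ a :* t) := b :+ y :* s :+ a :* (y :* t)) refl _ _ _ _ _)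

    -- Multiplication by `y` may create a term `d * y ^ n`. After one more factor `a` it is replaced
    -- by means of `a * y ^ n ≈ - p(y)`.
    reducible-y* : ∀ {φ} → Reducible φ → Reducible (λ y → y * φ y)
    reducible-y* {φ} (k , r , f) with shift 0ℤ r
    ... | s , d , e = suc k , Vec.zipWith ℤ._+_ s′ p′ , λ {y} root → begin
      A * A ^ k * (y * φ y)
        ≈⟨ solve 4 (λ a t y x → a :* t :* (y :* x) := a :* (con (+ 0) :+ y :* (t :* x))) refl _ _ _ _ ⟩
      A * (0# + y * (A ^ k * φ y))                ≈⟨ *-congˡ (+-congˡ (*-congˡ (f root))) ⟩
      A * ⟪ 0ℤ ∷ r ⟫ y                            ≈⟨ *-congˡ (e y) ⟩
      A * (⟪ s ⟫ y + fromℤ d * y ^ n)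
        ≈⟨ solve 4 (λ a s d t → a :* (s :+ d :* t) := a :* s :+ d :* (a :* t)) refl _ _ _ _ ⟩
      A * ⟪ s ⟫ y + fromℤ d * (A * y ^ n)         ≈⟨ +-congˡ (*-congˡ (x+y≈0⇒y≈-x root)) ⟩
      A * ⟪ s ⟫ y + fromℤ d * (- ⟪ p ⟫ y)         ≈⟨ +-congˡ (trans (sym (-‿distribʳ-* _ _)) (-‿distribˡ-* _ _)) ⟩
      A * ⟪ s ⟫ y + (- fromℤ d) * ⟪ p ⟫ y         ≈⟨ +-congˡ (*-congʳ (fromℤ-neg d)) ⟨
      A * ⟪ s ⟫ y + fromℤ (ℤ.- d) * ⟪ p ⟫ y       ≈⟨ +-cong (⟪⟫-* a s y) (⟪⟫-* (ℤ.- d) p y) ⟨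
      ⟪ s′ ⟫ y + ⟪ p′ ⟫ y                         ≈⟨ ⟪⟫-+ s′ p′ y ⟨
      ⟪ Vec.zipWith ℤ._+_ s′ p′ ⟫ y               ∎
      where
      A = fromℤ a
      s′ = Vec.map (a ℤ.*_) s
      p′ = Vec.map ((ℤ.- d) ℤ.*_) p

    reducible-y^* : ∀ N {φ} → Reducible φ → Reducible (λ y → y ^ N * φ y)
    reducible-y^* zero    f = reducible-ext (λ y → sym (*-identityˡ _)) f
    reducible-y^* (suc N) f = reducible-ext (λ y → sym (*-assoc _ _ _)) (reducible-y* (reducible-y^* N f))

    -- Horner's rule, with multiplication by `e * y ^ N` done as `N` multiplications by `y` and one
    -- by `e`.
    reducible-evalℤ : ∀ e N g → Reducible (λ y → evalℤ g (fromℤ e * y ^ N))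
    reducible-evalℤ e N []      = reducible-const 0ℤ
    reducible-evalℤ e N (b ∷ g) = reducible-+ (reducible-const b)
      (reducible-ext (λ y → sym (*-assoc _ _ _))
        (reducible-scale e (reducible-y^* N (reducible-evalℤ e N g))))

-- Integrality of `x` forced by that of `d * x ^ N` for large `N`.

n<2^n : ∀ n → n < 2 ℕ.^ n
n<2^n zero    = s≤s z≤n
n<2^n (suc n) = ℕ.≤-trans (ℕ.+-mono-≤ (ℕ.m^n>0 2 n) (n<2^n n)) (ℕ.≤-reflexive (≡.cong (2 ℕ.^ n ℕ.+_) (≡.sym (ℕ.+-identityʳ _))))

module Descent {c ℓ₁ ℓ₂} (Q̄ : AlgebraicNumbers c ℓ₁ ℓ₂) where

  open FieldProperties Q̄
  open Integrality Q̄
  open Rationals Q̄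
  open Polynomials Q̄

  -- Exponents are bounded in each variable separately: for `k = 1` the span consists of the
  -- multilinear expressions in `xs` with integral coefficients, and `N`-th powers of these lie in
  -- the span for `k = N`.
  Monomial : ℕ → List Carrier → Pred Carrier (c ⊔ ℓ₁)
  Monomial k []       y = Int y
  Monomial k (x ∷ xs) y = ∃[ i ] ∃[ u ] (i ≤ k × Monomial k xs u × y ≈ x ^ i * u)

  Monomial-* : ∀ {k l g h} xs → Monomial k xs g → Monomial l xs h → Monomial (k ℕ.+ l) xs (g * h)
  Monomial-* []       g-int h-int = Int-* g-int h-int
  Monomial-* (x ∷ xs) (i , u , i≤k , u-mon , g≈) (j , v , j≤l , v-mon , h≈) =
    i ℕ.+ j , u * v , ℕ.+-mono-≤ i≤k j≤l , Monomial-* xs u-mon v-mon , (begin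
      _                          ≈⟨ *-cong g≈ h≈ ⟩
      x ^ i * u * (x ^ j * v)    ≈⟨ solve 4 (λ s u t v → s :* u :* (t :* v) := s :* t :* (u :* v)) refl _ _ _ _ ⟩
      x ^ i * x ^ j * (u * v)    ≈⟨ *-congʳ (^-homo-* x i j) ⟨
      x ^ (i ℕ.+ j) * (u * v)    ∎)

  Monomial-1 : ∀ {k} xs → Monomial k xs 1#
  Monomial-1 []       = Int-1
  Monomial-1 (x ∷ xs) = 0 , 1# , z≤n , Monomial-1 xs , sym (*-identityˡ 1#)

  span-Monomial-^ : ∀ {xs z} N → ⟨ Monomial 1 xs ⟩ z → ⟨ Monomial N xs ⟩ (z ^ N)
  span-Monomial-^ {xs} zero    s = incl (Monomial-1 xs)
  span-Monomial-^ {xs} (suc N) s = span-* (λ g h → incl (Monomial-* xs g h)) s (span-Monomial-^ N s)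

  span-Monomial-∷ : ∀ {k x xs z} i → i ≤ k → ⟨ Monomial k xs ⟩ z → ⟨ Monomial k (x ∷ xs) ⟩ (x ^ i * z)
  span-Monomial-∷ i i≤k = span-scale (λ g → incl (i , _ , i≤k , g , refl))

  -- Each member of `xs` receives one factor of `e ^ length xs`, which is enough for any exponent up
  -- to `N`.
  Monomial-Int : ∀ {e N xs y} → All (λ x → ∀ i → i ≤ N → Int (e * x ^ i)) xs →
                 Monomial N xs y → Int (e ^ length xs * y)
  Monomial-Int []       y-int = Int-resp (sym (*-identityˡ _)) y-int
  Monomial-Int {e} {xs = x ∷ xs} (f ∷ fs) (i , u , i≤N , u-mon , y≈) = Int-resp
    (trans (solve 4 (λ e t s u → e :* t :* (s :* u) := e :* s :* (t :* u)) refl _ _ _ _) (*-congˡ (sym y≈)))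
    (Int-* (f i i≤N) (Monomial-Int fs u-mon))

  evalMonic : List Carrier → Carrier → Carrier
  evalMonic P = eval (P ++ [ 1# ])

  -- Lower coefficients of the quotient of the monic polynomial p ∷ P by T - x;
  -- it does not depend on p.
  quotient : Carrier → List Carrier → List Carrier
  quotient x []      = []
  quotient x (a ∷ P) = evalMonic (a ∷ P) x ∷ quotient x P

  length-quotient : ∀ x P → length (quotient x P) ≡ length P
  length-quotient x []      = ≡.refl
  length-quotient x (a ∷ P) = ≡.cong suc (length-quotient x P)

  -- Division by `T - x` has the value at `x` as remainder. Hence, if `x` is a root, every root of
  -- the quotient is a root too.
  evalMonic-quotient : ∀ x y a P →
    evalMonic (a ∷ P) y ≈ evalMonic (a ∷ P) x + (y - x) * evalMonic (quotient x P) y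
  evalMonic-quotient x y a []      = solve 3 (λ x y a →
    a :+ y :* (con (+ 1) :+ y :* con (+ 0)) :=
    a :+ x :* (con (+ 1) :+ x :* con (+ 0)) :+ (y :- x) :* (con (+ 1) :+ y :* con (+ 0))) refl x y a
  evalMonic-quotient x y a (b ∷ P) = trans (+-congˡ (*-congˡ (evalMonic-quotient x y b P)))
    (solve 5 (λ x y a s t → a :+ y :* (s :+ (y :- x) :* t) := a :+ x :* s :+ (y :- x) :* (s :+ y :* t))
      refl x y a _ _)

  -- By Horner's rule a coefficient is one partial value at `x` minus `x` times the next. The later
  -- values are coefficients of the quotient, multilinear in `xs`, so `x` enters with exponent at
  -- most 1.
  coefficients-Monomial : ∀ {x xs} a P → ⟨ Monomial 1 (x ∷ xs) ⟩ (evalMonic (a ∷ P) x) →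
    All ⟨ Monomial 1 xs ⟩ (quotient x P) → All ⟨ Monomial 1 (x ∷ xs) ⟩ (a ∷ P)
  coefficients-Monomial {x} {xs} a [] s [] =
    cast (solve 2 (λ a x → a :+ x :* (con (+ 1) :+ x :* con (+ 0)) :- x :* con (+ 1) :* con (+ 1) := a) refl a x)
      (s ⊕ (⊖ span-Monomial-∷ 1 ℕ.≤-refl (incl (Monomial-1 xs)))) ∷ []
  coefficients-Monomial {x} a (b ∷ P) s (t ∷ ts) =
    cast (solve 3 (λ a x e → a :+ x :* e :- x :* con (+ 1) :* e := a) refl a x _)
      (s ⊕ (⊖ span-Monomial-∷ 1 ℕ.≤-refl t)) ∷
    coefficients-Monomial b P (cast (*-identityˡ _) (span-Monomial-∷ 0 z≤n t)) ts

  -- Roots are peeled off one at a time. Multilinearity of the coefficients is carried along, in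
  -- place of explicit elementary symmetric polynomials.
  split : ∀ n P → length P ≡ n → ∃[ xs ] (length xs ≡ n ×
          All (λ x → evalMonic P x ≈ 0#) xs × All ⟨ Monomial 1 xs ⟩ P)
  split zero    []      _  = [] , ≡.refl , [] , []
  split (suc n) (a ∷ P) eq with algebraicallyClosed a P
  ... | x , root with split n (quotient x P) (≡.trans (length-quotient x P) (ℕ.suc-injective eq))
  ... | xs , len , roots , coeffs =
    x ∷ xs , ≡.cong suc len ,
    (root ∷ All.map (λ {y} e → trans (evalMonic-quotient x y a P)
      (trans (+-cong root (trans (*-congˡ e) (zeroʳ _))) (+-identityʳ 0#))) roots) ,
    coefficients-Monomial a P (cast (sym root) nil) coeffs

  Int-root : ∀ {x} N → Int (x ^ suc N) → Int x
  Int-root N s = Int-trans {d = N} (incl (0 , _ , s≤s z≤n , s , sym (*-identityʳ _)))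

  -- With `M = suc N`, the power `(e * x ^ i) ^ M` equals `e ^ (M - i) * (e * x ^ M) ^ i`, which is
  -- integral; then an `M`-th root is taken.
  Int-lowerPower : ∀ {e x} N → Int e → Int (e * x ^ suc N) → ∀ i → i ≤ suc N → Int (e * x ^ i)
  Int-lowerPower {e} {x} N e-int s i i≤N = Int-root N (Int-resp (begin
    e ^ (M ℕ.∸ i) * (e * x ^ M) ^ i           ≈⟨ *-congˡ (^-distrib-* e (x ^ M) i) ⟩
    e ^ (M ℕ.∸ i) * (e ^ i * (x ^ M) ^ i)     ≈⟨ *-assoc _ _ _ ⟨
    e ^ (M ℕ.∸ i) * e ^ i * (x ^ M) ^ i       ≈⟨ *-congʳ (^-homo-* e (M ℕ.∸ i) i) ⟨
    e ^ (M ℕ.∸ i ℕ.+ i) * (x ^ M) ^ i         ≈⟨ *-cong (^-congʳ e (ℕ.m∸n+n≡m i≤N)) (begin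
      (x ^ M) ^ i      ≈⟨ ^-assocʳ x M i ⟩
      x ^ (M ℕ.* i)    ≈⟨ ^-congʳ x (ℕ.*-comm M i) ⟩
      x ^ (i ℕ.* M)    ≈⟨ ^-assocʳ x i M ⟨
      (x ^ i) ^ M      ∎) ⟩
    e ^ M * (x ^ i) ^ M                       ≈⟨ ^-distrib-* e (x ^ i) M ⟨
    (e * x ^ i) ^ M                           ∎)
    (Int-* (Int-^ (M ℕ.∸ i) e-int) (Int-^ i s)))
    where M = suc N

  module _ {e : ℤ} (e≢0 : e ≢ 0ℤ) (N : ℕ) where

    private
      M = suc N

      e^n≢0 : ∀ n → e ℤ.^ n ≢ 0ℤ
      e^n≢0 n eq = ^-≉0 n (fromℤ-≉0 e≢0) (trans (sym (fromℤ-^ e n)) (reflexive (≡.cong fromℤ eq)))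

    -- Each coefficient q of the monic polynomial proportional to p + a T ^ n is
    -- multilinear in its roots, so e ^ n * q ^ M is integral, hence an integer.
    allRoots-Int : ∀ {n} (p : Vec ℤ n) {a} → a ≢ 0ℤ → ℤ.∣ e ℤ.^ n ∣ < 2 ℕ.^ M →
                   (∀ {y} → Root p a y → Int (fromℤ e * y ^ M)) → ∀ {x} → Root p a x → Int x
    allRoots-Int {n} p {a} a≢0 bound roots-Int {x} root with #0⇒inverse (≉0⇒# (fromℤ-≉0 a≢0))
    ... | A⁻¹ , A⁻¹A≈1 = monicRoot-Int P x P-Int (begin
        eval P x + x ^ length P            ≡⟨ ≡.cong (λ k → eval P x + x ^ k) length-P ⟩
        eval P x + x ^ n                   ≈⟨ +-cong (eval-P (Vec.toList p) x) (sym (trans (*-congʳ A⁻¹A≈1) (*-identityˡ _))) ⟩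
        A⁻¹ * ⟪ p ⟫ x + A⁻¹ * A * x ^ n
          ≈⟨ solve 4 (λ b s a t → b :* s :+ b :* a :* t := b :* (s :+ a :* t)) refl _ _ _ _ ⟩
        A⁻¹ * (⟪ p ⟫ x + A * x ^ n)        ≈⟨ trans (*-congˡ root) (zeroʳ _) ⟩
        0#                                 ∎)
      where
      A = fromℤ a

      monic : List ℤ → List Carrier
      monic = map (λ b → fromℤ b * A⁻¹)

      P = monic (Vec.toList p)

      length-P : length P ≡ n
      length-P = ≡.trans (List.length-map _ (Vec.toList p)) (Vec.length-toList p)

      eval-P : ∀ l y → eval (monic l) y ≈ A⁻¹ * evalℤ l y
      eval-P []      y = sym (zeroʳ _)
      eval-P (b ∷ l) y = trans (+-congˡ (*-congˡ (eval-P l y)))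
        (solve 4 (λ b a y s → b :* a :+ y :* (a :* s) := a :* (b :+ y :* s)) refl _ _ _ _)

      P-Root : ∀ {y} → evalMonic P y ≈ 0# → Root p a y
      P-Root {y} eq = *-cancel-0 (λ A⁻¹≈0 → 1≉0 (trans (sym A⁻¹A≈1) (trans (*-congʳ A⁻¹≈0) (zeroˡ _)))) (begin
        A⁻¹ * (⟪ p ⟫ y + A * y ^ n)
          ≈⟨ solve 4 (λ b s a t → b :* (s :+ a :* t) := b :* s :+ b :* a :* t) refl _ _ _ _ ⟩
        A⁻¹ * ⟪ p ⟫ y + A⁻¹ * A * y ^ n      ≈⟨ +-cong (sym (eval-P (Vec.toList p) y)) (*-congʳ A⁻¹A≈1) ⟩
        eval P y + 1# * y ^ n                ≡⟨ ≡.cong (λ k → eval P y + 1# * y ^ k) length-P ⟨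
        eval P y + 1# * y ^ length P         ≈⟨ eval-∷ʳ P 1# y ⟨
        evalMonic P y                        ≈⟨ eq ⟩
        0#                                   ∎)

      factorisation = split n P length-P
      xs = proj₁ factorisation

      xs-Int : All (λ x → ∀ i → i ≤ M → Int (fromℤ e * x ^ i)) xs
      xs-Int = All.map (λ eq → Int-lowerPower N (Int-fromℤ e) (roots-Int (P-Root eq)))
        (proj₁ (proj₂ (proj₂ factorisation)))

      coefficient-Int : ∀ {b} → ⟨ Monomial 1 xs ⟩ (fromℤ b * A⁻¹) → Int (fromℤ b * A⁻¹)
      coefficient-Int {b} s = let k , eq = q-Integer in Int-resp (sym eq) (Int-fromℤ k)
        where
        q = fromℤ b * A⁻¹

        Aq≈b : A * q ≈ fromℤ b
        Aq≈b = trans (solve 3 (λ a b i → a :* (b :* i) := b :* (i :* a)) refl _ _ _)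
          (trans (*-congˡ A⁻¹A≈1) (*-identityʳ _))

        eⁿq^M-Int : Int (fromℤ (e ℤ.^ n) * q ^ M)
        eⁿq^M-Int = Int-resp
          (*-congʳ (trans (^-congʳ (fromℤ e) (proj₁ (proj₂ factorisation))) (sym (fromℤ-^ e n))))
          (Int-span {G = Int} (λ z → z) (span-scale (λ g → incl (Monomial-Int xs-Int g)) (span-Monomial-^ M s)))

        eⁿq^M-Integer : Integer (fromℤ (e ℤ.^ n) * q ^ M)
        -- Since `A * q ≈ fromℤ b`, the factor `a ^ M` clears the denominator of `q ^ M`.
        eⁿq^M-Integer = Int-rational {a ℤ.^ M} {e ℤ.^ n ℤ.* b ℤ.^ M}
          (λ eq → ^-≉0 M (fromℤ-≉0 a≢0) (trans (sym (fromℤ-^ a M)) (reflexive (≡.cong fromℤ eq))))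
          (begin
            fromℤ (a ℤ.^ M) * (fromℤ (e ℤ.^ n) * q ^ M)   ≈⟨ *-congʳ (fromℤ-^ a M) ⟩
            A ^ M * (fromℤ (e ℤ.^ n) * q ^ M)
              ≈⟨ solve 3 (λ a e t → a :* (e :* t) := e :* (a :* t)) refl _ _ _ ⟩
            fromℤ (e ℤ.^ n) * (A ^ M * q ^ M)             ≈⟨ *-congˡ (^-distrib-* A q M) ⟨
            fromℤ (e ℤ.^ n) * (A * q) ^ M                 ≈⟨ *-congˡ (^-congˡ M Aq≈b) ⟩
            fromℤ (e ℤ.^ n) * fromℤ b ^ M                 ≈⟨ *-congˡ (fromℤ-^ b M) ⟨
            fromℤ (e ℤ.^ n) * fromℤ (b ℤ.^ M)             ≈⟨ fromℤ-* (e ℤ.^ n) (b ℤ.^ M) ⟨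
            fromℤ (e ℤ.^ n ℤ.* b ℤ.^ M)                   ∎)
          eⁿq^M-Int

        q-Integer : Integer q
        q-Integer = bounded-denominator {a} {b} (e ℤ.^ n) M a≢0 (e^n≢0 n) bound Aq≈b eⁿq^M-Integer

      P-Int : All Int P
      P-Int = All.map⁺ (All.map (λ {b} → coefficient-Int {b}) (All.map⁻ (proj₂ (proj₂ (proj₂ factorisation)))))

    -- Either every root y of p + a T ^ n is a root of the monic equation of
    -- e * x ^ M evaluated at e * y ^ M, or reducing the latter modulo
    -- p + a T ^ n yields an annihilator of x of smaller degree.
    descend : ∀ {x n} → Acc _<_ n → (p : Vec ℤ n) → ∀ {a} → a ≢ 0ℤ → ℤ.∣ e ∣ ℕ.^ n < 2 ℕ.^ M →
              Root p a x → Int (fromℤ e * x ^ M) → Int x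
    descend {x} {n} (acc rec) p {a} a≢0 bound root s with Int⇒IntegralOverℤ s
    ... | g , g≈0 with reducible-evalℤ e M (g ++ [ 1ℤ ])
      where open PseudoDivision p a≢0
    ... | k , r , reduced with leading (Vec.toList r)
    ... | inj₁ r≡0 = allRoots-Int p a≢0 (≡.subst (_< 2 ℕ.^ M) (≡.sym (abs-^ e n)) bound)
      (λ {y} y-root → IntegralOverℤ⇒Int (g , *-cancel-0 (^-≉0 k (fromℤ-≉0 a≢0))
        (trans (reduced y-root) (evalℤ-0 r≡0 y)))) root
    ... | inj₂ (n′ , p′ , a′ , n′<len , a′≢0 , r≈) =
      -- As `e` is nonzero, a smaller degree only lowers the power of its absolute value, so the
      -- same exponent `M` serves throughout the descent.
      descend (rec n′<n) p′ a′≢0 (ℕ.≤-<-trans (ℕ.^-monoʳ-≤ ℤ.∣ e ∣ (ℕ.<⇒≤ n′<n)) bound)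
        (trans (sym (r≈ x)) (trans (sym (reduced root)) (trans (*-congˡ g≈0) (zeroʳ _)))) s
      where
      n′<n : n′ < n
      n′<n = ≡.subst (n′ <_) (Vec.length-toList r) n′<len
      instance
        e-nonZero : ℕ.NonZero ℤ.∣ e ∣
        e-nonZero = ℕ.≢-nonZero (λ eq → e≢0 (ℤ.∣i∣≡0⇒i≡0 eq))

  -- The premise `¬ d ≈ 0#` sits inside, so that thresholds exist for all pairs, even before `d` is
  -- known to be nonzero.
  IntegralFrom : ℕ → Carrier × Carrier → Set (c ⊔ ℓ₁)
  IntegralFrom N₀ (d , x) = ∀ N → N₀ ≤ N → ¬ d ≈ 0# → Int (d * x ^ N) → Int x

  -- An integer `e` with `e * d⁻¹` integral turns `d * x ^ N` into `e * x ^ N`. Both `e` and the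
  -- annihilator of `x` are chosen before `N`, so the threshold is independent of `N`.
  Int-eventually : ∀ d x → ∃[ N₀ ] IntegralFrom N₀ (d , x)
  Int-eventually d x with d #? 0#
  ... | no ¬d#0 = 0 , λ _ _ d≉0 _ → ⊥-elim (d≉0 (proj₁ (tight _ _) ¬d#0))
  ... | yes d#0 with #0⇒inverse d#0
  ... | d⁻¹ , d⁻¹d≈1 with denominator d⁻¹ | algebraic-Root x
  ... | e , e≢0 , ed⁻¹-Int | n , p , a , a≢0 , root = suc (ℤ.∣ e ∣ ℕ.^ n) , λ where
    (suc N) (s≤s N₀≤N) _ s → descend e≢0 N (<-wellFounded n) p a≢0
      (ℕ.<-≤-trans (n<2^n (ℤ.∣ e ∣ ℕ.^ n)) (ℕ.^-monoʳ-≤ 2 (ℕ.m≤n⇒m≤1+n N₀≤N))) root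
      (Int-resp (begin
        fromℤ e * d⁻¹ * (d * x ^ suc N)
          ≈⟨ solve 4 (λ e i d t → e :* i :* (d :* t) := e :* (i :* d :* t)) refl _ _ _ _ ⟩
        fromℤ e * (d⁻¹ * d * x ^ suc N)    ≈⟨ *-congˡ (trans (*-congʳ d⁻¹d≈1) (*-identityˡ _)) ⟩
        fromℤ e * x ^ suc N                ∎)
        (Int-* ed⁻¹-Int s))

  Int-eventuallyAll : ∀ dxs → ∃[ N₀ ] All (IntegralFrom N₀) dxs
  Int-eventuallyAll []              = 0 , []
  Int-eventuallyAll ((d , x) ∷ dxs) with Int-eventually d x | Int-eventuallyAll dxs
  ... | N₁ , f | N₂ , fs = N₁ ℕ.+ N₂ ,
    (λ N N₀≤N → f N (ℕ.m+n≤o⇒m≤o N₁ N₀≤N)) ∷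
    All.map (λ g N N₀≤N → g N (ℕ.m+n≤o⇒n≤o N₁ N₀≤N)) fs

-- Hankel identities and the uniform bound.

module TwoTermSums {c ℓ₁ ℓ₂} (Q̄ : AlgebraicNumbers c ℓ₁ ℓ₂) where

  open FieldProperties Q̄
  open Integrality Q̄
  open Rationals Q̄
  open Polynomials Q̄
  open Descent Q̄

  private variable
    α₁ α₂ β₁ β₂ : Carrier

  sum^ : (β₁ β₂ α₁ α₂ : Carrier) → ℕ → Carrier
  sum^ β₁ β₂ α₁ α₂ i = β₁ * α₁ ^ i + β₂ * α₂ ^ i

  -- The 2 by 2 Hankel matrix starting at `m i` is Vᵀ diag(β₁ α₁^i, β₂ α₂^i) V, where V has rows (1,
  -- α₁) and (1, α₂); passing from 0 to `i` multiplies its determinant by `(α₁ * α₂) ^ i`.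
  hankel : ∀ β₁ β₂ α₁ α₂ i → let m = sum^ β₁ β₂ α₁ α₂ in
    m i * m (2 ℕ.+ i) - m (1 ℕ.+ i) * m (1 ℕ.+ i) ≈
    (m 0 * m 2 - m 1 * m 1) * (α₁ * α₂) ^ i
  hankel β₁ β₂ α₁ α₂ i = trans
    (solve 6 (λ b₁ b₂ a₁ a₂ t u →
      (b₁ :* t :+ b₂ :* u) :* (b₁ :* (a₁ :* (a₁ :* t)) :+ b₂ :* (a₂ :* (a₂ :* u)))
        :- (b₁ :* (a₁ :* t) :+ b₂ :* (a₂ :* u)) :* (b₁ :* (a₁ :* t) :+ b₂ :* (a₂ :* u)) :=
      ((b₁ :* con (+ 1) :+ b₂ :* con (+ 1)) :*
         (b₁ :* (a₁ :* (a₁ :* con (+ 1))) :+ b₂ :* (a₂ :* (a₂ :* con (+ 1))))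
        :- (b₁ :* (a₁ :* con (+ 1)) :+ b₂ :* (a₂ :* con (+ 1))) :*
           (b₁ :* (a₁ :* con (+ 1)) :+ b₂ :* (a₂ :* con (+ 1)))) :* (t :* u))
      refl β₁ β₂ α₁ α₂ (α₁ ^ i) (α₂ ^ i))
    (*-congˡ (sym (^-distrib-* α₁ α₂ i)))

  -- Determines `α₁ + α₂` from the first four sums when the determinant is nonzero, as `hankel` with
  -- `i = 1` does for `α₁ * α₂`.
  hankel-sum : ∀ β₁ β₂ α₁ α₂ → let m = sum^ β₁ β₂ α₁ α₂ in
    m 0 * m 3 - m 1 * m 2 ≈ (m 0 * m 2 - m 1 * m 1) * (α₁ + α₂)
  hankel-sum = solve 4 (λ b₁ b₂ a₁ a₂ →
    let i = con (+ 1)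
        m₀ = b₁ :* i :+ b₂ :* i
        m₁ = b₁ :* (a₁ :* i) :+ b₂ :* (a₂ :* i)
        m₂ = b₁ :* (a₁ :* (a₁ :* i)) :+ b₂ :* (a₂ :* (a₂ :* i))
        m₃ = b₁ :* (a₁ :* (a₁ :* (a₁ :* i))) :+ b₂ :* (a₂ :* (a₂ :* (a₂ :* i)))
    in m₀ :* m₃ :- m₁ :* m₂ := (m₀ :* m₂ :- m₁ :* m₁) :* (a₁ :+ a₂)) refl

  hankel₀ : ∀ β₁ β₂ α₁ α₂ → let m = sum^ β₁ β₂ α₁ α₂ in
    m 0 * m 2 - m 1 * m 1 ≈ β₁ * β₂ * ((α₁ - α₂) * (α₁ - α₂))
  hankel₀ = solve 4 (λ b₁ b₂ a₁ a₂ →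
    let i = con (+ 1)
        m₀ = b₁ :* i :+ b₂ :* i
        m₁ = b₁ :* (a₁ :* i) :+ b₂ :* (a₂ :* i)
        m₂ = b₁ :* (a₁ :* (a₁ :* i)) :+ b₂ :* (a₂ :* (a₂ :* i))
    in m₀ :* m₂ :- m₁ :* m₁ := b₁ :* b₂ :* ((a₁ :- a₂) :* (a₁ :- a₂))) refl

  x-y≈0⇒x≈y : ∀ {x y} → x - y ≈ 0# → x ≈ y
  x-y≈0⇒x≈y {x} {y} e = begin
    x            ≈⟨ solve 2 (λ x y → x := x :- y :+ y) refl x y ⟩
    x - y + y    ≈⟨ +-congʳ e ⟩
    0# + y       ≈⟨ +-identityˡ y ⟩
    y            ∎

  _≈?0 : ∀ x → (x ≈ 0#) ⊎ (¬ x ≈ 0#)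
  x ≈?0 with x #? 0#
  ... | yes x#0 = inj₂ (#0⇒≉0 x#0)
  ... | no ¬x#0 = inj₁ (proj₁ (tight _ _) ¬x#0)

  hankel₀≈0⇒≈ : ¬ β₁ ≈ 0# → ¬ β₂ ≈ 0# → let m = sum^ β₁ β₂ α₁ α₂ in
                m 0 * m 2 - m 1 * m 1 ≈ 0# → α₁ ≈ α₂
  hankel₀≈0⇒≈ {β₁} {β₂} {α₁} {α₂} β₁≉0 β₂≉0 e with (α₁ - α₂) ≈?0
  ... | inj₁ α₁-α₂≈0 = x-y≈0⇒x≈y α₁-α₂≈0
  ... | inj₂ α₁-α₂≉0 = ⊥-elim (*-≉0 (*-≉0 β₁≉0 β₂≉0) (*-≉0 α₁-α₂≉0 α₁-α₂≉0)
    (trans (sym (hankel₀ β₁ β₂ α₁ α₂)) e))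

  -- X = d β₁ α₁ ^ N and Y = d β₂ α₂ ^ N have integral sum and product.
  summand-Int : ∀ {d} N → Int d → Int (d * (β₁ * β₂)) → Int (α₁ * α₂) →
                Int (sum^ β₁ β₂ α₁ α₂ N) → Int (d * β₁ * α₁ ^ N)
  summand-Int {β₁} {β₂} {α₁} {α₂} {d} N d-int dββ-int αα-int m-int =
    monicRoot-Int (d * (d * (β₁ * β₂)) * (α₁ * α₂) ^ N ∷ - (d * sum^ β₁ β₂ α₁ α₂ N) ∷ []) _
      (Int-* (Int-* d-int dββ-int) (Int-^ N αα-int) ∷ Int-neg (Int-* d-int m-int) ∷ [])
      (trans (+-congʳ (+-congʳ (*-congˡ (^-distrib-* α₁ α₂ N))))
        (solve 5 (λ d b₁ b₂ t u → d :* (d :* (b₁ :* b₂)) :* (t :* u)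
            :+ d :* b₁ :* t :* (:- (d :* (b₁ :* t :+ b₂ :* u)) :+ d :* b₁ :* t :* con (+ 0))
            :+ d :* b₁ :* t :* (d :* b₁ :* t :* con (+ 1)) := con (+ 0))
          refl d β₁ β₂ (α₁ ^ N) (α₂ ^ N)))

  -- The product `(α - r) * (α - (s - r))` is minus the value of the quadratic at `r`. One root
  -- fixed in advance thus leaves two candidates for `α`, and thresholds can be prepared for both.
  vieta : ∀ {p s r α α′} → evalMonic (p ∷ - s ∷ []) r ≈ 0# → α + α′ ≈ s → α * α′ ≈ p →
          (α ≈ r) ⊎ (α ≈ s - r)
  vieta {p} {s} {r} {α} {α′} root sum≈ prod≈ with (α - r) ≈?0
  ... | inj₁ α-r≈0 = inj₁ (x-y≈0⇒x≈y α-r≈0)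
  ... | inj₂ α-r≉0 = inj₂ (x-y≈0⇒x≈y (*-cancel-0 α-r≉0 (begin
    (α - r) * (α - (s - r))
      ≈⟨ *-congˡ (+-congˡ (-‿cong (+-congʳ sum≈))) ⟨
    (α - r) * (α - (α + α′ - r))
      ≈⟨ solve 3 (λ r a a′ → (a :- r) :* (a :- (a :+ a′ :- r)) :=
           :- (a :* a′ :+ r :* (:- (a :+ a′) :+ r :* (con (+ 1) :+ r :* con (+ 0))))) refl r α α′ ⟩
    - evalMonic (α * α′ ∷ - (α + α′) ∷ []) r
      ≈⟨ -‿cong (+-cong prod≈ (*-congˡ (+-congʳ (-‿cong sum≈)))) ⟩
    - evalMonic (p ∷ - s ∷ []) r
      ≈⟨ trans (-‿cong root) -0#≈0# ⟩
    0# ∎)))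

  Sufficient : (m₀ m₁ m₂ m₃ β₁ β₂ : Carrier) → ℕ → Set (c ⊔ ℓ₁)
  Sufficient m₀ m₁ m₂ m₃ β₁ β₂ C = ∀ {α₁ α₂} → let m = sum^ β₁ β₂ α₁ α₂ in
    ¬ β₁ ≈ 0# → ¬ β₂ ≈ 0# → ¬ (α₁ ≈ α₂ × β₁ + β₂ ≈ 0#) →
    m 0 ≈ m₀ → m 1 ≈ m₁ → m 2 ≈ m₂ → m 3 ≈ m₃ →
    (∀ i → 1 ≤ i → i ≤ C → Int (m i)) → Int α₁ × Int α₂

  solve-* : ∀ {x y z i} → i * x ≈ 1# → z ≈ x * y → y ≈ i * z
  solve-* {x} {y} {z} {i} ix≈1 z≈xy = begin
    y              ≈⟨ *-identityˡ y ⟨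
    1# * y         ≈⟨ *-congʳ ix≈1 ⟨
    i * x * y      ≈⟨ *-assoc i x y ⟩
    i * (x * y)    ≈⟨ *-congˡ z≈xy ⟨
    i * z          ∎

  module _ (m₀ m₁ m₂ m₃ β₁ β₂ : Carrier) where

    D = m₀ * m₂ - m₁ * m₁

    D-cong : ∀ {n₀ n₁ n₂} → n₀ ≈ m₀ → n₁ ≈ m₁ → n₂ ≈ m₂ → n₀ * n₂ - n₁ * n₁ ≈ D
    D-cong e₀ e₁ e₂ = +-cong (*-cong e₀ e₂) (-‿cong (*-cong e₁ e₁))

    degenerate : D ≈ 0# → ∃[ C ] Sufficient m₀ m₁ m₂ m₃ β₁ β₂ C
    degenerate D≈0 with (β₁ + β₂) ≈?0
    -- Here `α₁ ≈ α₂` and `β₁ + β₂ ≈ 0#` contradict the hypotheses, so any bound will do.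
    ... | inj₁ β≈0 = 0 , λ β₁≉0 β₂≉0 nontrivial e₀ e₁ e₂ _ _ →
      ⊥-elim (nontrivial (hankel₀≈0⇒≈ β₁≉0 β₂≉0 (trans (D-cong e₀ e₁ e₂) D≈0) , β≈0))
    ... | inj₂ β≉0 with #0⇒inverse (≉0⇒# β≉0)
    -- `σ * m₁` is the common value of `α₁` and `α₂`, computed before they are given.
    ... | σ , σβ≈1 with Int-eventually (β₁ + β₂) (σ * m₁)
    ... | N , f = suc N , λ {α₁} {α₂} β₁≉0 β₂≉0 _ e₀ e₁ e₂ _ m-int →
      let α₁≈α₂ = hankel₀≈0⇒≈ {α₁ = α₁} β₁≉0 β₂≉0 (trans (D-cong e₀ e₁ e₂) D≈0)
          sum^≈ : ∀ i → sum^ β₁ β₂ α₁ α₂ i ≈ (β₁ + β₂) * α₁ ^ i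
          sum^≈ i = trans (+-congˡ (*-congˡ (^-congˡ i (sym α₁≈α₂)))) (sym (distribʳ _ _ _))
          α₁≈ = solve-* {y = α₁} σβ≈1 (trans (sym e₁) (trans (sum^≈ 1) (*-congˡ (*-identityʳ α₁))))
          α₁-int = Int-resp (sym α₁≈) (f (suc N) (ℕ.n≤1+n N) β≉0
            (Int-resp (trans (sum^≈ (suc N)) (*-congˡ (^-congˡ (suc N) α₁≈))) (m-int (suc N) (s≤s z≤n) ℕ.≤-refl)))
      in α₁-int , Int-resp α₁≈α₂ α₁-int

    nondegenerate : ¬ D ≈ 0# → ∃[ C ] Sufficient m₀ m₁ m₂ m₃ β₁ β₂ C
    nondegenerate D≉0 with #0⇒inverse (≉0⇒# D≉0) | denominator (β₁ * β₂)
    ... | D⁻¹ , D⁻¹D≈1 | a , a≢0 , aββ-int = fromRoot (algebraicallyClosed p [ - s ])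
      where
      -- By the Hankel identities `p` and `s` must be the product and the sum of the `αᵢ`, the roots
      -- of `T ^ 2 - s T + p`.
      p = D⁻¹ * (m₁ * m₃ - m₂ * m₂)
      s = D⁻¹ * (m₀ * m₃ - m₁ * m₂)
      A = fromℤ a

      fromRoot : ∃[ r ] evalMonic (p ∷ - s ∷ []) r ≈ 0# → ∃[ C ] Sufficient m₀ m₁ m₂ m₃ β₁ β₂ C
      -- Which `αᵢ` is `r` is not known yet, so each of the factors `A * β₁`, `A * β₂` is paired
      -- with both candidates.
      fromRoot (r , root) with Int-eventuallyAll
        ((D , p) ∷ (A * β₁ , r) ∷ (A * β₁ , s - r) ∷ (A * β₂ , r) ∷ (A * β₂ , s - r) ∷ [])
      -- The Hankel identity at `N` involves `m` up to index `2 + N`. Taking `N = suc N₀` avoids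
      -- index 0, where integrality is not assumed.
      ... | N₀ , from-p ∷ from-r₁ ∷ from-r₁′ ∷ from-r₂ ∷ from-r₂′ ∷ [] = 2 ℕ.+ N , suffices
        where
        N = suc N₀

        conclude : ∀ {β α} → ¬ β ≈ 0# → IntegralFrom N₀ (A * β , r) → IntegralFrom N₀ (A * β , s - r) →
                   (α ≈ r) ⊎ (α ≈ s - r) → Int (A * β * α ^ N) → Int α
        conclude β≉0 from-r _ (inj₁ α≈) i = Int-resp (sym α≈) (from-r N (ℕ.n≤1+n N₀)
          (*-≉0 (fromℤ-≉0 a≢0) β≉0) (Int-resp (*-congˡ (^-congˡ N α≈)) i))
        conclude β≉0 _ from-r′ (inj₂ α≈) i = Int-resp (sym α≈) (from-r′ N (ℕ.n≤1+n N₀)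
          (*-≉0 (fromℤ-≉0 a≢0) β≉0) (Int-resp (*-congˡ (^-congˡ N α≈)) i))

        suffices : Sufficient m₀ m₁ m₂ m₃ β₁ β₂ (2 ℕ.+ N)
        suffices {α₁} {α₂} β₁≉0 β₂≉0 _ e₀ e₁ e₂ e₃ m-int =
          conclude β₁≉0 from-r₁ from-r₁′ (vieta root s≈ p≈)
            (summand-Int N (Int-fromℤ a) aββ-int αα-int m[N]-int) ,
          -- The same argument with the indices exchanged, whence the appeals to commutativity.
          conclude β₂≉0 from-r₂ from-r₂′ (vieta root (trans (+-comm _ _) s≈) (trans (*-comm _ _) p≈))
            (summand-Int {α₂ = α₁} N (Int-fromℤ a) (Int-resp (*-congˡ (*-comm _ _)) aββ-int)
              (Int-resp (*-comm _ _) αα-int) (Int-resp (+-comm _ _) m[N]-int))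
          where
          D≈ = D-cong e₀ e₁ e₂

          p≈ : α₁ * α₂ ≈ p
          p≈ = solve-* D⁻¹D≈1 (trans (sym (+-cong (*-cong e₁ e₃) (-‿cong (*-cong e₂ e₂))))
            (trans (hankel β₁ β₂ α₁ α₂ 1) (*-cong D≈ (*-identityʳ _))))

          s≈ : α₁ + α₂ ≈ s
          s≈ = solve-* D⁻¹D≈1 (trans (sym (+-cong (*-cong e₀ e₃) (-‿cong (*-cong e₁ e₂))))
            (trans (hankel-sum β₁ β₂ α₁ α₂) (*-congʳ D≈)))

          m[N]-int : Int (sum^ β₁ β₂ α₁ α₂ N)
          m[N]-int = m-int N (s≤s z≤n) (ℕ.m≤n+m N 2)

          m[1+N]-int : Int (sum^ β₁ β₂ α₁ α₂ (1 ℕ.+ N))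
          m[1+N]-int = m-int (1 ℕ.+ N) (s≤s z≤n) (ℕ.n≤1+n (1 ℕ.+ N))

          αα-int : Int (α₁ * α₂)
          αα-int = Int-resp (sym p≈) (from-p N (ℕ.n≤1+n N₀) D≉0 (Int-resp
            (trans (hankel β₁ β₂ α₁ α₂ N) (*-cong D≈ (^-congˡ N p≈)))
            (Int-+ (Int-* m[N]-int (m-int (2 ℕ.+ N) (s≤s z≤n) ℕ.≤-refl))
              (Int-neg (Int-* m[1+N]-int m[1+N]-int)))))

    sufficient : ∃[ C ] Sufficient m₀ m₁ m₂ m₃ β₁ β₂ C
    sufficient with D ≈?0
    ... | inj₁ D≈0 = degenerate D≈0
    ... | inj₂ D≉0 = nondegenerate D≉0

-- The bound for rings of integers.

theorem2p9 :
    ∀ {c ℓ₁ ℓ₂ : Level} (Q̄ : AlgebraicNumbers c ℓ₁ ℓ₂) →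
    let open AlgebraicNumbers Q̄ in
    (m₀ m₁ m₂ m₃ λ₁ λ₂ : Carrier) →
    ∃[ C ] ((α₁ α₂ : Carrier) →
      let m : ℕ → Carrier
          m i = λ₁ * α₁ ^ i + λ₂ * α₂ ^ i
          K = ℚ⟨ λ₁ ∷ λ₂ ∷ α₁ ∷ α₂ ∷ [] ⟩
      in
      α₁ # 0# → α₂ # 0# → λ₁ # 0# → λ₂ # 0# →
      -- without this m vanishes identically and α₁ = α₂ is arbitrary
      ¬ (α₁ ≈ α₂ × λ₁ + λ₂ ≈ 0#) →
      m 0 ≈ m₀ → m 1 ≈ m₁ → m 2 ≈ m₂ → m 3 ≈ m₃ →
      (∀ i → 1 ≤ i → i ≤ C → 𝒪 K (m i)) →
      𝒪 K α₁ × 𝒪 K α₂)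
theorem2p9 Q̄ m₀ m₁ m₂ m₃ λ₁ λ₂ with TwoTermSums.sufficient Q̄ m₀ m₁ m₂ m₃ λ₁ λ₂
... | C , suffices = C , λ α₁ α₂ _ _ λ₁#0 λ₂#0 nontrivial e₀ e₁ e₂ e₃ m-integral →
  let α₁-int , α₂-int = suffices (#0⇒≉0 λ₁#0) (#0⇒≉0 λ₂#0) nontrivial e₀ e₁ e₂ e₃
        (λ i 1≤i i≤C → IntegralOverℤ⇒Int (proj₂ (m-integral i 1≤i i≤C)))
  -- The `αᵢ` lie in `K` as generators; their integrality is turned from stable modules back into
  -- monic polynomials.
  in (gen (there (there (here refl))) , Int⇒IntegralOverℤ α₁-int) ,
     (gen (there (there (there (here refl)))) , Int⇒IntegralOverℤ α₂-int)
  where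
  open AlgebraicNumbers Q̄
  open Rationals Q̄
  open Polynomials Q̄
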